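{- Let $G$ be a finite simple graph with maximum degree $\Delta_G$. Then the fractional strong chromatic index of $G$ satisfies $\chi'_{fs}(G) \le 1.75\,\Delta_G^2$.
   Context: An induced matching of $G$ is a set of pairwise disjoint edges of $G$ such that no edge of $G$ joins endpoints of two distinct edges of the set. Let $M(G)$ be the set of induced matchings of $G$. A fractional strong edge coloring of $G$ is a non-negative weighting $w: M(G)\to \mathbb{R}_{\ge 0}$ such that for each edge $e \in E(G)$, $\sum_{m \in M(G):\, e \in m} w(m) = 1$; its weight is $\sum_{m \in M(G)} w(m)$. The fractional strong chromatic index $\chi'_{fs}(G)$ is the minimum weight of a fractional strong edge coloring of $G$. -}

module Defs where

open import Data.Nat as ℕ using (ℕ; _⊔_)
open import Data.Bool using (Bool; true; false; if_then_else_)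
open import Data.Fin using (Fin)
open import Data.List using (List; []; _∷_; allFin; map; foldr; filter; length)
open import Data.Product using (_×_; _,_; proj₁; proj₂; Σ-syntax)
open import Data.Sum using (_⊎_)
open import Data.Empty using (⊥)
open import Relation.Nullary using (¬_)
open import Relation.Binary.PropositionalEquality using (_≡_)
open import Data.Integer using (+_)
open import Data.Rational as ℚ using (ℚ; 0ℚ; _≤_; _/_)

record Graph (n : ℕ) : Set where
  field
    adj    : Fin n → Fin n → Bool
    sym    : ∀ u v → adj u v ≡ adj v u
    irrefl : ∀ u → adj u u ≡ false
open Graph public

Adj : ∀ {n} → Graph n → Fin n → Fin n → Set
Adj G u v = adj G u v ≡ true

degree : ∀ {n} → Graph n → Fin n → ℕ
degree {n} G v = length (filter (λ u → Data.Bool._≟_ (adj G v u) true) (allFin n))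
  where import Data.Bool

maxDegree : ∀ {n} → Graph n → ℕ
maxDegree {n} G = foldr _⊔_ 0 (map (degree G) (allFin n))

record EdgeSet {n} (G : Graph n) : Set where
  field
    mem     : Fin n → Fin n → Bool
    mem-sym : ∀ u v → mem u v ≡ mem v u
    mem-adj : ∀ u v → mem u v ≡ true → Adj G u v
open EdgeSet public

SameEdge : ∀ {n} → Fin n → Fin n → Fin n → Fin n → Set
SameEdge u v x y = (u ≡ x × v ≡ y) ⊎ (u ≡ y × v ≡ x)

IsInducedMatching : ∀ {n} {G : Graph n} → EdgeSet G → Set
IsInducedMatching {n} {G} S =
  ∀ u v x y → mem S u v ≡ true → mem S x y ≡ true → ¬ SameEdge u v x y →
    (¬ u ≡ x × ¬ u ≡ y × ¬ v ≡ x × ¬ v ≡ y)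
    × (¬ Adj G u x × ¬ Adj G u y × ¬ Adj G v x × ¬ Adj G v y)

InducedMatching : ∀ {n} → Graph n → Set
InducedMatching G = Σ[ S ∈ EdgeSet G ] IsInducedMatching S

-- A finitely supported non-negative weighting of induced matchings, given as a
-- list of (induced matching, weight) entries (repeated matchings simply have
-- their weights added).
Weighting : ∀ {n} → Graph n → Set
Weighting G = List (InducedMatching G × ℚ)

sumℚ : List ℚ → ℚ
sumℚ = foldr ℚ._+_ 0ℚ

NonNeg : ∀ {n} {G : Graph n} → Weighting G → Set
NonNeg [] = Data.Unit.⊤ where import Data.Unit
NonNeg ((_ , q) ∷ w) = (0ℚ ≤ q) × NonNeg w

load : ∀ {n} {G : Graph n} → Weighting G → Fin n → Fin n → ℚ
load [] u v = 0ℚ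
load (((S , _) , q) ∷ w) u v =
  (if mem S u v then q else 0ℚ) ℚ.+ load w u v

weight : ∀ {n} {G : Graph n} → Weighting G → ℚ
weight [] = 0ℚ
weight ((_ , q) ∷ w) = q ℚ.+ weight w

IsFractionalStrongEdgeColoring : ∀ {n} (G : Graph n) → Weighting G → Set
IsFractionalStrongEdgeColoring G w =
  NonNeg w × (∀ u v → Adj G u v → load w u v ≡ ℚ.1ℚ)

-- χ'_fs(G) ≤ b  :⇔  some fractional strong edge coloring has weight ≤ b
-- (the minimum of the defining LP is attained and rational)
χ'fs≤ : ∀ {n} → Graph n → ℚ → Set
χ'fs≤ G b = Σ[ w ∈ Weighting G ] (IsFractionalStrongEdgeColoring G w × weight w ≤ b)

{-# OPTIONS --safe #-}
module Submission where

-- Two edges conflict if they are equal, share an endpoint or are joined by an edge; a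
-- fractional strong edge colouring is a fractional colouring of the conflict graph.
--
-- Fractional colourings (Molloy–Reed, McDiarmid): repeatedly raise the weight of all
-- maximum stable sets of the unsaturated vertices uniformly until a vertex has total
-- weight 1. If S is a random maximum stable set and |S ∩ N[v]| = 1, say S ∩ N[v] = {u}, then
-- S − u + v is again maximum, and the u belonging to one such set form a clique. Hence
-- E|S ∩ N[v]| + ω Pr(v ∈ S) ≥ 2 as long as v is unsaturated, and integrating this shows that
-- the total weight is at most (|N[v]| + ω) / 2 for the last vertex v to be saturated.
--
-- For conflicting edges |N[v]| ≤ 2Δ², and ω ≤ 3Δ²/2: let v have maximum degree D in the
-- clique and let U be its clique-neighbours. A clique edge xy outside N(v) satisfies
-- p(x) + p(y) ≥ D, where p counts the neighbours in U, so its unit weight can be split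
-- between x and y such that every x pays at most 3p(x)/2, clique edges to U included.
-- As p sums to at most DΔ and N(v) ∖ U meets at most (Δ − D)D clique edges, the clique
-- has at most 3DΔ/2 + (Δ − D)D ≤ 3Δ²/2 edges.

open import Defs
open import Data.Nat using (ℕ; _*_)
open import Data.Integer using (+_)
open import Data.Rational using (ℚ; _/_)
open import Data.Rational using () renaming (_*_ to _*ℚ_)

open import Data.Bool using (Bool; true; false; if_then_else_; not; _∧_; _∨_)
open import Data.Bool.Properties
  using (not-involutive; ¬-not; ∨-comm; ∨-identityʳ) renaming (_≟_ to _≟ᵇ_)
open import Data.Fin using (Fin; zero; suc; combine; remQuot; _↑ˡ_; _↑ʳ_)
import Data.Fin as Fin using (_<_)
import Data.Fin.Properties as Fin using (_<?_; <-cmp)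
open import Data.Fin.Properties using (_≟_; all?; any?; remQuot-combine; combine-injective)
open import Data.Fin.Subset using (Subset; ∣_∣; ⊥)
open import Data.Fin.Subset.Properties using (anySubset?; ∣p∣≤n)
import Data.Integer as ℤ using (_+_; _*_; _≤_; +≤+)
import Data.Integer.Properties as ℤ
import Data.Integer.Tactic.RingSolver as ℤSolver
open import Data.List using (List; []; _∷_; _++_; allFin; map; filter; length; foldr)
open import Data.List.Membership.Propositional using (_∈_)
open import Data.List.Membership.Propositional.Properties
  using (∈-allFin; ∈-map⁺; ∈-map⁻; ∈-++⁺ˡ; ∈-++⁺ʳ; ∈-++⁻; ∈-filter⁺; ∈-filter⁻)
open import Data.List.Properties using (map-++; map-∘; map-tabulate)
open import Data.List.Relation.Unary.Any using (here; there)
open import Data.Nat using (zero; suc; _+_; _∸_; _⊓_; _⊔_; _≤_; _<_; z≤n; s≤s; >-nonZero)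
import Data.Nat as ℕ using (_≟_; _/_)
open import Data.Nat.DivMod using (/-monoˡ-≤; m*n/n≡m; m/n*n≤m)
open import Data.Nat.ListAction using (sum)
open import Data.Nat.ListAction.Properties using (sum-++)
open import Data.Nat.Properties hiding (_≟_)
open import Data.Nat.Tactic.RingSolver using (solve-∀)
open import Data.Product using (∃; _×_; _,_; proj₁; proj₂)
open import Data.Rational using (0ℚ; 1ℚ; toℚᵘ)
import Data.Rational as ℚ
import Data.Rational.Properties as ℚ
open import Data.Rational.Unnormalised using (mkℚᵘ; *≡*; *≤*) renaming (_≃_ to _≃ᵘ_)
import Data.Rational.Unnormalised as ℚᵘ
import Data.Rational.Unnormalised.Properties as ℚᵘ
open import Data.Sum using (_⊎_; inj₁; inj₂)
open import Data.Vec using ([]; _∷_; lookup; updateAt)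
open import Data.Vec.Properties using (lookup∘updateAt; lookup∘updateAt′; lookup-replicate)
open import Function using (_∘_; id)
open import Relation.Binary.Definitions using (tri<; tri≈; tri>)
open import Relation.Binary.PropositionalEquality
  using (_≡_; _≢_; refl; cong; cong₂; subst; trans; module ≡-Reasoning)
  renaming (sym to ≡-sym)
open import Relation.Nullary using (Dec; yes; no; does; contradiction; _×-dec_; _→-dec_)
open import Relation.Nullary.Decidable using (dec-true; map′)
open import Relation.Unary using (Decidable)

private variable
  A B : Set
  m n : ℕ

-- Booleans and 0/1 indicators

∨⁻ : ∀ a {b} → a ∨ b ≡ true → a ≡ true ⊎ b ≡ true
∨⁻ true  _  = inj₁ refl
∨⁻ false eq = inj₂ eq

∨⁺ˡ : ∀ {a b} → a ≡ true → a ∨ b ≡ true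
∨⁺ˡ refl = refl

∨⁺ʳ : ∀ a {b} → b ≡ true → a ∨ b ≡ true
∨⁺ʳ true  _  = refl
∨⁺ʳ false eq = eq

∧⁻ : ∀ {a b} → a ∧ b ≡ true → a ≡ true × b ≡ true
∧⁻ {true} eq = refl , eq

⟦_⟧ : Bool → ℕ
⟦ b ⟧ = if b then 1 else 0

⟦⟧≤1 : ∀ b → ⟦ b ⟧ ≤ 1
⟦⟧≤1 true  = s≤s z≤n
⟦⟧≤1 false = z≤n

⟦∧⟧ : ∀ a b → ⟦ a ∧ b ⟧ ≡ ⟦ a ⟧ * ⟦ b ⟧
⟦∧⟧ true  b = ≡-sym (*-identityˡ ⟦ b ⟧)
⟦∧⟧ false b = refl

⟦⟧*-≤ : ∀ b {k l} → (b ≡ true → k ≤ l) → ⟦ b ⟧ * k ≤ l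
⟦⟧*-≤ true  {k} h = ≤-trans (≤-reflexive (*-identityˡ k)) (h refl)
⟦⟧*-≤ false     h = z≤n

⟦⟧-mono : ∀ b {k} → (b ≡ true → 1 ≤ k) → ⟦ b ⟧ ≤ k
⟦⟧-mono true  h = h refl
⟦⟧-mono false h = z≤n

-- Finite sums of natural numbers

∑ : List A → (A → ℕ) → ℕ
∑ xs f = sum (map f xs)

syntax ∑ xs (λ x → e) = ∑[ x ∈ xs ] e
infixr 5 ∑

module _ {f g : A → ℕ} where

  ∑-cong : ∀ xs → (∀ x → f x ≡ g x) → ∑ xs f ≡ ∑ xs g
  ∑-cong []       eq = refl
  ∑-cong (x ∷ xs) eq = cong₂ _+_ (eq x) (∑-cong xs eq)

  ∑-mono-∈ : ∀ xs → (∀ {x} → x ∈ xs → f x ≤ g x) → ∑ xs f ≤ ∑ xs g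
  ∑-mono-∈ []       le = z≤n
  ∑-mono-∈ (x ∷ xs) le = +-mono-≤ (le (here refl)) (∑-mono-∈ xs (le ∘ there))

  ∑-mono : ∀ xs → (∀ x → f x ≤ g x) → ∑ xs f ≤ ∑ xs g
  ∑-mono xs le = ∑-mono-∈ xs (λ {x} _ → le x)

  ∑-mono-< : ∀ {xs y} → y ∈ xs → (∀ x → f x ≤ g x) → f y < g y → ∑ xs f < ∑ xs g
  ∑-mono-< {x ∷ xs} (here refl) le lt = +-mono-<-≤ lt (∑-mono xs le)
  ∑-mono-< {x ∷ xs} (there y∈)  le lt = +-mono-≤-< (le x) (∑-mono-< y∈ le lt)

∑-+ : ∀ xs {f g : A → ℕ} → ∑[ x ∈ xs ] (f x + g x) ≡ ∑ xs f + ∑ xs g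
∑-+ []                   = refl
∑-+ (x ∷ xs) {f} {g} rewrite ∑-+ xs {f} {g} = lemma (f x) (g x) (∑ xs f) (∑ xs g)
  where
  lemma : ∀ a b c d → (a + b) + (c + d) ≡ (a + c) + (b + d)
  lemma = solve-∀

∑-*ˡ : ∀ xs k {f : A → ℕ} → ∑[ x ∈ xs ] (k * f x) ≡ k * ∑ xs f
∑-*ˡ []       k     = ≡-sym (*-zeroʳ k)
∑-*ˡ (x ∷ xs) k {f} rewrite ∑-*ˡ xs k {f} = ≡-sym (*-distribˡ-+ k (f x) (∑ xs f))

∑-*ʳ : ∀ xs k {f : A → ℕ} → ∑[ x ∈ xs ] (f x * k) ≡ ∑ xs f * k
∑-*ʳ []       k     = refl
∑-*ʳ (x ∷ xs) k {f} rewrite ∑-*ʳ xs k {f} = ≡-sym (*-distribʳ-+ k (f x) (∑ xs f))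

∑-zero : ∀ (xs : List A) → ∑[ x ∈ xs ] 0 ≡ 0
∑-zero []       = refl
∑-zero (x ∷ xs) = ∑-zero xs

∑-const : ∀ (xs : List A) k → ∑[ x ∈ xs ] k ≡ length xs * k
∑-const []       k = refl
∑-const (x ∷ xs) k = cong₂ _+_ (refl {x = k}) (∑-const xs k)

∑-swap : ∀ (xs : List A) (ys : List B) {f : A → B → ℕ} →
         ∑[ x ∈ xs ] (∑[ y ∈ ys ] f x y) ≡ ∑[ y ∈ ys ] (∑[ x ∈ xs ] f x y)
∑-swap []       ys     = ≡-sym (∑-zero ys)
∑-swap (x ∷ xs) ys {f} rewrite ∑-swap xs ys {f} = ≡-sym (∑-+ ys)

∑-++ : ∀ (xs ys : List A) f → ∑ (xs ++ ys) f ≡ ∑ xs f + ∑ ys f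
∑-++ xs ys f rewrite map-++ f xs ys = sum-++ (map f xs) (map f ys)

∑-map : ∀ (h : A → B) xs f → ∑ (map h xs) f ≡ ∑ xs (f ∘ h)
∑-map h xs f = cong sum (≡-sym (map-∘ xs))

∑-filter : ∀ {P : A → Set} (P? : Decidable P) xs f →
           ∑ (filter P? xs) f ≡ ∑[ x ∈ xs ] ⟦ does (P? x) ⟧ * f x
∑-filter P? []       f = refl
∑-filter P? (x ∷ xs) f with does (P? x)
... | true  = cong₂ _+_ (≡-sym (*-identityˡ (f x))) (∑-filter P? xs f)
... | false = ∑-filter P? xs f

∈⇒≤∑ : ∀ {xs : List A} {x} f → x ∈ xs → f x ≤ ∑ xs f
∈⇒≤∑ {xs = y ∷ xs} f (here refl) = m≤m+n (f y) (∑ xs f)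
∈⇒≤∑ {xs = y ∷ xs} f (there x∈)  = ≤-trans (∈⇒≤∑ f x∈) (m≤n+m (∑ xs f) (f y))

∈∈⇒+≤∑ : ∀ {xs : List A} {x y} f → x ∈ xs → y ∈ xs → x ≢ y → f x + f y ≤ ∑ xs f
∈∈⇒+≤∑ f (here refl) (here refl) x≢y = contradiction refl x≢y
∈∈⇒+≤∑ f (here refl) (there y∈)  x≢y = +-monoʳ-≤ (f _) (∈⇒≤∑ f y∈)
∈∈⇒+≤∑ {x = x} {y} f (there x∈) (here refl) x≢y =
  ≤-trans (≤-reflexive (+-comm (f x) (f y))) (+-monoʳ-≤ (f y) (∈⇒≤∑ f x∈))
∈∈⇒+≤∑ {xs = z ∷ xs} f (there x∈) (there y∈)  x≢y =
  ≤-trans (∈∈⇒+≤∑ f x∈ y∈ x≢y) (m≤n+m (∑ xs f) (f z))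

∑-allFin-suc : ∀ (f : Fin (suc n) → ℕ) →
               ∑ (allFin (suc n)) f ≡ f zero + ∑ (allFin n) (f ∘ suc)
∑-allFin-suc f = cong (λ ys → f zero + sum ys)
  (trans (map-tabulate suc f) (≡-sym (map-tabulate id (f ∘ suc))))

∑-allFin-+ : ∀ m n (f : Fin (m + n) → ℕ) →
  ∑ (allFin (m + n)) f ≡ ∑ (allFin m) (λ i → f (i ↑ˡ n)) + ∑ (allFin n) (λ j → f (m ↑ʳ j))
∑-allFin-+ zero    n f = refl
∑-allFin-+ (suc m) n f
  rewrite ∑-allFin-suc f | ∑-allFin-+ m n (f ∘ suc) | ∑-allFin-suc (λ i → f (i ↑ˡ n))
  = ≡-sym (+-assoc (f zero) _ _)

-- For passing from sums over edge codes to sums over ordered pairs of vertices.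
∑-combine : ∀ m n (f : Fin (m * n) → ℕ) →
  ∑ (allFin (m * n)) f ≡ ∑[ i ∈ allFin m ] (∑[ j ∈ allFin n ] f (combine i j))
∑-combine zero    n f = refl
∑-combine (suc m) n f
  rewrite ∑-allFin-+ n (m * n) f | ∑-combine m n (f ∘ (n ↑ʳ_))
  = ≡-sym (∑-allFin-suc (λ i → ∑ (allFin n) (λ j → f (combine {suc m} i j))))

maximiser : ∀ (f : A → ℕ) xs →
  ∑ xs f ≡ 0 ⊎ (∃ λ y → 0 < f y × (∀ {x} → x ∈ xs → f x ≤ f y))
maximiser f [] = inj₁ refl
maximiser f (z ∷ xs) with maximiser f xs
... | inj₁ ∑≡0 with f z in fz
...   | zero  = inj₁ ∑≡0
...   | suc k = inj₂ (z , subst (0 <_) (≡-sym fz) (s≤s z≤n) ,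
  λ { (here refl) → ≤-refl
    ; (there x∈) → ≤-trans (∈⇒≤∑ f x∈) (≤-trans (≤-reflexive ∑≡0) z≤n) })
maximiser f (z ∷ xs) | inj₂ (y , fy>0 , max) with ≤-total (f z) (f y)
... | inj₁ z≤y = inj₂ (y , fy>0 , λ { (here refl) → z≤y ; (there x∈) → max x∈ })
... | inj₂ y≤z = inj₂ (z , ≤-trans fy>0 y≤z ,
  λ { (here refl) → ≤-refl ; (there x∈) → ≤-trans (max x∈) y≤z })

dec-true⁻ : ∀ {P : Set} (P? : Dec P) → does P? ≡ true → P
dec-true⁻ (yes p) refl = p

-- Subsets of Fin n

_∋_ : Subset n → Fin n → Set
S ∋ i = lookup S i ≡ true

flip : Fin n → Subset n → Subset n
flip i S = updateAt S i not

flip-involutive : ∀ (i : Fin n) S → flip i (flip i S) ≡ S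
flip-involutive zero    (b ∷ S) = cong (_∷ S) (not-involutive b)
flip-involutive (suc i) (b ∷ S) = cong (b ∷_) (flip-involutive i S)

flip-∋ : ∀ (i : Fin n) S → lookup S i ≡ false → flip i S ∋ i
flip-∋ i S i∉S = trans (lookup∘updateAt i S) (cong not i∉S)

flip-∌ : ∀ (i : Fin n) S → S ∋ i → lookup (flip i S) i ≡ false
flip-∌ i S i∈S = trans (lookup∘updateAt i S) (cong not i∈S)

flip-≢ : ∀ (i : Fin n) S {j} → j ≢ i → lookup (flip i S) j ≡ lookup S j
flip-≢ i S {j} j≢i = lookup∘updateAt′ j i j≢i S

flip-∋⁻ : ∀ (i : Fin n) S {j} → flip i S ∋ j → j ≡ i ⊎ S ∋ j
flip-∋⁻ i S {j} j∈ with j ≟ i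
... | yes j≡i = inj₁ j≡i
... | no  j≢i = inj₂ (trans (≡-sym (flip-≢ i S j≢i)) j∈)

∣flip∣ : ∀ (i : Fin n) S → lookup S i ≡ false → ∣ flip i S ∣ ≡ suc ∣ S ∣
∣flip∣ zero    (false ∷ S) refl = refl
∣flip∣ (suc i) (true  ∷ S) i∉S  = cong suc (∣flip∣ i S i∉S)
∣flip∣ (suc i) (false ∷ S) i∉S  = ∣flip∣ i S i∉S

∣flip∣⁻ : ∀ (i : Fin n) S → S ∋ i → suc ∣ flip i S ∣ ≡ ∣ S ∣
∣flip∣⁻ i S i∈S = trans (≡-sym (∣flip∣ i (flip i S) (flip-∌ i S i∈S)))
                        (cong ∣_∣ (flip-involutive i S))

subsets : ∀ n → List (Subset n)
subsets zero    = [] ∷ []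
subsets (suc n) = map (false ∷_) (subsets n) ++ map (true ∷_) (subsets n)

∈-subsets : ∀ (S : Subset n) → S ∈ subsets n
∈-subsets []          = here refl
∈-subsets (false ∷ S) = ∈-++⁺ˡ (∈-map⁺ (false ∷_) (∈-subsets S))
∈-subsets (true  ∷ S) = ∈-++⁺ʳ (map (false ∷_) (subsets _)) (∈-map⁺ (true ∷_) (∈-subsets S))

∑-subsets-suc : ∀ n (f : Subset (suc n) → ℕ) → ∑ (subsets (suc n)) f ≡
  ∑ (subsets n) (f ∘ (false ∷_)) + ∑ (subsets n) (f ∘ (true ∷_))
∑-subsets-suc n f = trans (∑-++ (map (false ∷_) (subsets n)) _ f)
  (cong₂ _+_ (∑-map (false ∷_) (subsets n) f) (∑-map (true ∷_) (subsets n) f))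

-- Flipping one element permutes the subsets. This is the change of variables behind the exchange of
-- S for S - u + v.
∑-flip : ∀ (i : Fin n) f → ∑ (subsets n) (f ∘ flip i) ≡ ∑ (subsets n) f
∑-flip {suc n} zero f = trans (∑-subsets-suc n (f ∘ flip zero))
  (trans (+-comm (∑ (subsets n) (f ∘ (true ∷_))) _) (≡-sym (∑-subsets-suc n f)))
∑-flip {suc n} (suc i) f = trans (∑-subsets-suc n (f ∘ flip (suc i)))
  (trans (cong₂ _+_ (∑-flip i (f ∘ (false ∷_))) (∑-flip i (f ∘ (true ∷_))))
         (≡-sym (∑-subsets-suc n f)))

maximum-subset : ∀ {P : Subset n → Set} → Decidable P → ∃ P →
                 ∃ λ S → P S × (∀ {T} → P T → ∣ T ∣ ≤ ∣ S ∣)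
maximum-subset {n} {P} P? (S₀ , PS₀) = go n S₀ PS₀ (m≤m+n n ∣ S₀ ∣)
  where
  -- The hypothesis `n ≤ k + ∣ S ∣` lets `k` bound the number of enlargements still possible.
  go : ∀ k S → P S → n ≤ k + ∣ S ∣ → ∃ λ S → P S × (∀ {T} → P T → ∣ T ∣ ≤ ∣ S ∣)
  go k S PS n≤ with anySubset? (λ T → P? T ×-dec (∣ S ∣ <? ∣ T ∣))
  ... | no  none = S , PS , λ {T} PT → ≮⇒≥ (λ S<T → none (T , PT , S<T))
  go zero    S PS n≤ | yes (T , PT , S<T) =
    contradiction (<-≤-trans S<T (≤-trans (∣p∣≤n T) n≤)) (<-irrefl refl)
  go (suc k) S PS n≤ | yes (T , PT , S<T) = go k T PT
    (≤-trans n≤ (≤-trans (≤-reflexive (≡-sym (+-suc k ∣ S ∣))) (+-monoʳ-≤ k S<T)))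

-- Minimises r / c where c is positive, by cross multiplication.
min-ratio : ∀ (r c : A → ℕ) xs →
  (∀ {x} → x ∈ xs → c x ≡ 0) ⊎
  (∃ λ y → 0 < c y × (∀ {x} → x ∈ xs → r y * c x ≤ r x * c y))
min-ratio r c [] = inj₁ λ ()
min-ratio r c (z ∷ xs) with c z in cz | min-ratio r c xs
... | zero  | inj₁ all0 = inj₁ λ { (here refl) → cz ; (there x∈) → all0 x∈ }
... | zero  | inj₂ (y , cy>0 , min) = inj₂ (y , cy>0 ,
  λ { (here refl) → ≤-trans (≤-reflexive (trans (cong (r y *_) cz) (*-zeroʳ (r y)))) z≤n
    ; (there x∈) → min x∈ })
... | suc k | inj₁ all0 = inj₂ (z , subst (0 <_) (≡-sym cz) (s≤s z≤n) ,
  λ { (here refl) → ≤-refl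
    ; (there x∈) → ≤-trans (≤-reflexive (trans (cong (r z *_) (all0 x∈)) (*-zeroʳ (r z)))) z≤n })
... | suc k | inj₂ (y , cy>0 , min) with ≤-total (r y * c z) (r z * c y)
...   | inj₁ y≤z = inj₂ (y , cy>0 , λ { (here refl) → y≤z ; (there x∈) → min x∈ })
...   | inj₂ z≤y = inj₂ (z , subst (0 <_) (≡-sym cz) (s≤s z≤n) ,
  λ { (here refl) → ≤-refl ; (there {x = _} x∈) → below x∈ })
  where
  open ≤-Reasoning
  assoc-swap : ∀ a b c → a * b * c ≡ a * c * b
  assoc-swap = solve-∀
  -- Transitivity of cross-multiplied comparisons goes through `y`, whose denominator is positive
  -- and can be cancelled.
  below : ∀ {x} → x ∈ xs → r z * c x ≤ r x * c z
  below {x} x∈ = *-cancelʳ-≤ _ _ (c y) {{>-nonZero cy>0}} (begin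
    r z * c x * c y  ≡⟨ assoc-swap (r z) (c x) (c y) ⟩
    r z * c y * c x  ≤⟨ *-monoˡ-≤ (c x) z≤y ⟩
    r y * c z * c x  ≡⟨ assoc-swap (r y) (c z) (c x) ⟩
    r y * c x * c z  ≤⟨ *-monoˡ-≤ (c z) (min x∈) ⟩
    r x * c y * c z  ≡⟨ assoc-swap (r x) (c y) (c z) ⟩
    r x * c z * c y  ∎)

-- Fractional colourings and stable sets

-- Graphs enter as their reflexive adjacency relation R, so that R v is the closed
-- neighbourhood of v.
module FractionalColouring {N : ℕ} (R : Fin N → Fin N → Bool)
  (R-refl : ∀ i → R i i ≡ true) (R-sym : ∀ i j → R i j ≡ true → R j i ≡ true) where

  Vertices : List (Fin N)
  Vertices = allFin N

  record Stable (a : Fin N → Bool) (S : Subset N) : Set where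
    constructor mkStable
    field
      within      : ∀ i → S ∋ i → a i ≡ true
      independent : ∀ i j → S ∋ i → S ∋ j → R i j ≡ true → i ≡ j
  open Stable public

  stable? : ∀ a → Decidable (Stable a)
  stable? a S = map′ (λ (S⊆a , indep) → mkStable S⊆a indep)
    (λ stable → within stable , independent stable) (
    all? (λ i → (lookup S i ≟ᵇ true) →-dec (a i ≟ᵇ true)) ×-dec
    all? (λ i → all? (λ j →
      (lookup S i ≟ᵇ true) →-dec ((lookup S j ≟ᵇ true) →-dec ((R i j ≟ᵇ true) →-dec (i ≟ j))))))

  -- Since `R` is reflexive, the pairwise condition does not have to exclude i = j.
  CliquesBoundedBy : ℕ → (Fin N → Bool) → Set
  CliquesBoundedBy ω a = ∀ (Q : Fin N → Bool) → (∀ i → Q i ≡ true → a i ≡ true) →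
    (∀ i j → Q i ≡ true → Q j ≡ true → R i j ≡ true) → ∑[ i ∈ Vertices ] ⟦ Q i ⟧ ≤ ω

  stable-⊆ : ∀ {a S T} → (∀ i → T ∋ i → S ∋ i) → Stable a S → Stable a T
  stable-⊆ T⊆S (mkStable S⊆a indep) = mkStable
    (λ i → S⊆a i ∘ T⊆S i) (λ i j i∈ j∈ → indep i j (T⊆S i i∈) (T⊆S j j∈))

  -- Whether the flip adds or removes v, each member of `flip v S` is v or a member of S, so one
  -- argument serves both cases.
  stable-flip : ∀ {a S v} → a v ≡ true → (∀ i → S ∋ i → R v i ≡ true → v ≡ i) →
                Stable a S → Stable a (flip v S)
  stable-flip {a} {S} {v} av sep (mkStable S⊆a indep) = mkStable ⊆a indep′
    where
    ⊆a : ∀ i → flip v S ∋ i → a i ≡ true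
    ⊆a i i∈ with flip-∋⁻ v S i∈
    ... | inj₁ refl = av
    ... | inj₂ i∈S  = S⊆a i i∈S
    indep′ : ∀ i j → flip v S ∋ i → flip v S ∋ j → R i j ≡ true → i ≡ j
    indep′ i j i∈ j∈ Rij with flip-∋⁻ v S i∈ | flip-∋⁻ v S j∈
    ... | inj₁ refl | inj₁ refl = refl
    ... | inj₁ refl | inj₂ j∈S  = sep j j∈S Rij
    ... | inj₂ i∈S  | inj₁ refl = ≡-sym (sep i i∈S (R-sym i j Rij))
    ... | inj₂ i∈S  | inj₂ j∈S  = indep i j i∈S j∈S Rij

  -- Maximum stable sets and exchanges between them

  module MaximumStable (a : Fin N → Bool) where

    -- Later arguments need only the maximality of the set; `abstract` keeps the search over all
    -- subsets from unfolding.
    abstract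
      best : ∃ λ S → Stable a S × (∀ {T} → Stable a T → ∣ T ∣ ≤ ∣ S ∣)
      best = maximum-subset (stable? a)
        (⊥ , mkStable (λ i i∈ → absurd i i∈) (λ i j i∈ → absurd i i∈))
        where
        absurd : ∀ {P : Set} i → ⊥ {N} ∋ i → P
        absurd i i∈ with () ← trans (≡-sym i∈) (lookup-replicate i false)

    α : ℕ
    α = ∣ proj₁ best ∣

    ∣stable∣≤α : ∀ {T} → Stable a T → ∣ T ∣ ≤ α
    ∣stable∣≤α = proj₂ (proj₂ best)

    record Maximum (S : Subset N) : Set where
      constructor mkMaximum
      field
        stable : Stable a S
        size   : ∣ S ∣ ≡ α
    open Maximum renaming (stable to maximum-stable) public

    abstract
      maximum? : Decidable Maximum
      maximum? S = map′ (λ (stable , size) → mkMaximum stable size)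
                        (λ max → maximum-stable max , size max)
                        (stable? a S ×-dec (∣ S ∣ ℕ.≟ α))

    maxima : List (Subset N)
    maxima = filter maximum? (subsets N)

    maxima-nonempty : 1 ≤ length maxima
    maxima-nonempty with maxima | ∈-filter⁺ maximum? (∈-subsets _) (mkMaximum (proj₁ (proj₂ best)) refl)
    ... | _ ∷ _ | _ = s≤s z≤n

    ∈-maxima⁻ : ∀ {S} → S ∈ maxima → Maximum S
    ∈-maxima⁻ = proj₂ ∘ ∈-filter⁻ maximum? {xs = subsets N}

    cover : Fin N → ℕ
    cover v = ∑[ S ∈ maxima ] ⟦ lookup S v ⟧

    cover-outside : ∀ v → a v ≡ false → cover v ≡ 0
    cover-outside v av = n≤0⇒n≡0 (≤-trans
      (∑-mono-∈ {g = λ _ → 0} maxima (λ {S} S∈ → ⟦⟧-mono (lookup S v) (λ v∈S →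
         contradiction (trans (≡-sym av) (within (maximum-stable (∈-maxima⁻ S∈)) v v∈S)) λ ())))
      (≤-reflexive (∑-zero maxima)))

    meets : Fin N → Subset N → ℕ
    meets v S = ∑[ u ∈ Vertices ] ⟦ R v u ⟧ * ⟦ lookup S u ⟧

    module _ {v : Fin N} (av : a v ≡ true) where

      -- Otherwise S + v would be a larger stable set.
      meets≥1 : ∀ {S} → Maximum S → 1 ≤ meets v S
      meets≥1 {S} (mkMaximum stable ∣S∣≡α) with any? (λ u → (R v u ≟ᵇ true) ×-dec (lookup S u ≟ᵇ true))
      ... | yes (u , Rvu , u∈S) = ≤-trans
        (≤-reflexive (≡-sym (cong₂ (λ x y → ⟦ x ⟧ * ⟦ y ⟧) Rvu u∈S)))
        (∈⇒≤∑ (λ u → ⟦ R v u ⟧ * ⟦ lookup S u ⟧) (∈-allFin u))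
      ... | no none = contradiction (∣stable∣≤α bigger) (<⇒≱ (≤-reflexive
              (trans (cong suc (≡-sym ∣S∣≡α)) (≡-sym (∣flip∣ v S v∉S)))))
        where
        v∉S : lookup S v ≡ false
        v∉S = ¬-not (λ v∈S → none (v , R-refl v , v∈S))
        bigger : Stable a (flip v S)
        bigger = stable-flip av (λ i i∈S Rvi → contradiction (i , Rvi , i∈S) none) stable

      meets-single : ∀ {S u} → meets v S ≡ 1 → R v u ≡ true → S ∋ u →
                     ∀ i → S ∋ i → R v i ≡ true → i ≡ u
      meets-single {S} {u} single Rvu u∈S i i∈S Rvi with i ≟ u
      ... | yes i≡u = i≡u
      ... | no  i≢u = contradiction
        (≤-trans (≤-reflexive (≡-sym (cong₂ _+_ (cong₂ (λ x y → ⟦ x ⟧ * ⟦ y ⟧) Rvi i∈S)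
                                                (cong₂ (λ x y → ⟦ x ⟧ * ⟦ y ⟧) Rvu u∈S))))
          (≤-trans (∈∈⇒+≤∑ (λ u → ⟦ R v u ⟧ * ⟦ lookup S u ⟧) (∈-allFin i) (∈-allFin u) i≢u)
                   (≤-reflexive single)))
        λ { (s≤s ()) }

      exchange : Fin N → Subset N → Subset N
      exchange u S = flip v (flip u S)

      exchange⁻ : Fin N → Subset N → Subset N
      exchange⁻ u T = flip u (flip v T)

      exchange⁻-exchange : ∀ u S → exchange⁻ u (exchange u S) ≡ S
      exchange⁻-exchange u S = trans (cong (flip u) (flip-involutive v (flip u S)))
                                     (flip-involutive u S)

      -- Once u is removed, S has no element left in the closed neighbourhood of v, so v can be
      -- added and the size is restored. If u = v the two flips cancel.
      exchange-maximum : ∀ {u S} → Maximum S → S ∋ u → R v u ≡ true →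
        (∀ i → S ∋ i → R v i ≡ true → i ≡ u) → Maximum (exchange u S) × exchange u S ∋ v
      exchange-maximum {u} {S} max@(mkMaximum stable ∣S∣≡α) u∈S Rvu only with v ≟ u
      ... | yes refl = subst (λ T → Maximum T × T ∋ v) (≡-sym (flip-involutive v S)) (max , u∈S)
      ... | no  v≢u  = mkMaximum (stable-flip av separated (stable-⊆ shrinks stable))
                       (trans (∣flip∣ v (flip u S) v∉) (trans (∣flip∣⁻ u S u∈S) ∣S∣≡α)) ,
                       flip-∋ v (flip u S) v∉
        where
        v∉ : lookup (flip u S) v ≡ false
        v∉ = trans (flip-≢ u S v≢u) (¬-not (λ v∈S → v≢u (only v v∈S (R-refl v))))
        shrinks : ∀ i → flip u S ∋ i → S ∋ i
        shrinks i i∈ with flip-∋⁻ u S i∈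
        ... | inj₁ refl = u∈S
        ... | inj₂ i∈S  = i∈S
        separated : ∀ i → flip u S ∋ i → R v i ≡ true → v ≡ i
        separated i i∈ Rvi with refl ← only i (shrinks i i∈) Rvi =
          contradiction (trans (≡-sym i∈) (flip-∌ u S u∈S)) λ ()

      -- If u₁ and u₂ were not adjacent, T − v + u₁ + u₂ would be a larger stable set.
      exchangeable-clique : ∀ {T} → Maximum T → T ∋ v → ∀ u₁ u₂ →
        R v u₁ ≡ true → Maximum (exchange⁻ u₁ T) → R v u₂ ≡ true → Maximum (exchange⁻ u₂ T) →
        R u₁ u₂ ≡ true
      exchangeable-clique {T} T-max v∈T u₁ u₂ R₁ (mkMaximum stable₁ ∣S₁∣≡α) R₂ (mkMaximum stable₂ _)
        with R u₁ u₂ in R₁₂ | u₁ ≟ v | u₂ ≟ v | u₁ ≟ u₂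
      ... | true  | _        | _        | _        = refl
      ... | false | yes refl | _        | _        = trans (≡-sym R₁₂) R₂
      ... | false | no _     | yes refl | _        = trans (≡-sym R₁₂) (R-sym v u₁ R₁)
      ... | false | no _     | no _     | yes refl = trans (≡-sym R₁₂) (R-refl u₁)
      ... | false | no u₁≢v  | no u₂≢v  | no u₁≢u₂ =
        contradiction (∣stable∣≤α (stable-flip (within stable₂ u₂ u₂∈S₂) separated stable₁))
          (<⇒≱ (≤-reflexive (trans (cong suc (≡-sym ∣S₁∣≡α)) (≡-sym (∣flip∣ u₂ S₁ u₂∉S₁)))))
        where
        S₁ S₂ : Subset N
        S₁ = exchange⁻ u₁ T
        S₂ = exchange⁻ u₂ T
        u₂∉T : lookup (flip v T) u₂ ≡ false
        u₂∉T = trans (flip-≢ v T u₂≢v) (¬-not (λ u₂∈T →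
          u₂≢v (≡-sym (independent (maximum-stable T-max) v u₂ v∈T u₂∈T R₂))))
        u₂∉S₁ : lookup S₁ u₂ ≡ false
        u₂∉S₁ = trans (flip-≢ u₁ (flip v T) (u₁≢u₂ ∘ ≡-sym)) u₂∉T
        u₂∈S₂ : S₂ ∋ u₂
        u₂∈S₂ = flip-∋ u₂ (flip v T) u₂∉T
        separated : ∀ i → S₁ ∋ i → R u₂ i ≡ true → u₂ ≡ i
        separated i i∈ R₂ᵢ with flip-∋⁻ u₁ (flip v T) i∈
        ... | inj₁ refl = contradiction (trans (≡-sym R₁₂) (R-sym u₂ u₁ R₂ᵢ)) λ ()
        ... | inj₂ i∈T with i ≟ u₂
        ...   | yes refl = refl
        ...   | no i≢u₂  = independent stable₂ u₂ i u₂∈S₂ (trans (flip-≢ u₂ (flip v T) i≢u₂) i∈T) R₂ᵢ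

      private
        one : ℕ → ℕ
        one k = ⟦ does (k ℕ.≟ 1) ⟧

        -- A set that meets the closed neighbourhood of v only once is compensated by the second
        -- term. Its factor `k` is 1 whenever `one k` is, and it is kept so that `singly-met` can
        -- expand the term over the elements met.
        k+k*one≥2 : ∀ {k} → 1 ≤ k → 2 ≤ k + k * one k
        k+k*one≥2 {suc zero}    _ = ≤-refl
        k+k*one≥2 {suc (suc k)} _ = s≤s (s≤s z≤n)

        mx : Subset N → Bool
        mx S = does (maximum? S)

        -- h u S = 1 iff S is maximum and meets the closed neighbourhood of v in {u}; then
        -- S − u + v is a maximum stable set T that contains v and for which h′ u T = 1.
        h h′ : Fin N → Subset N → ℕ
        h  u S = ⟦ mx S ⟧ * (⟦ R v u ⟧ * (⟦ lookup S u ⟧ * one (meets v S)))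
        h′ u T = ⟦ mx T ⟧ * (⟦ lookup T v ⟧ * ⟦ R v u ∧ mx (exchange⁻ u T) ⟧)

        h≤h′ : ∀ u S → h u S ≤ h′ u (exchange u S)
        h≤h′ u S = ⟦⟧*-≤ (mx S) λ mxS → ⟦⟧*-≤ (R v u) λ Rvu → ⟦⟧*-≤ (lookup S u) λ u∈S →
          ⟦⟧-mono (does (meets v S ℕ.≟ 1)) λ single → positive mxS Rvu u∈S
            (exchange-maximum (dec-true⁻ (maximum? S) mxS) u∈S Rvu
              (meets-single {S} (dec-true⁻ (meets v S ℕ.≟ 1) single) Rvu u∈S))
          where
          positive : mx S ≡ true → R v u ≡ true → S ∋ u →
                     Maximum (exchange u S) × exchange u S ∋ v → 1 ≤ h′ u (exchange u S)
          positive mxS Rvu u∈S (max , v∈)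
            rewrite dec-true (maximum? (exchange u S)) max | v∈ | Rvu
                  | exchange⁻-exchange u S | mxS = ≤-refl

        -- As a composite of two flips, `exchange u` permutes all subsets, so the pointwise
        -- comparison passes to the sums.
        h≤h′-sum : ∀ u → ∑ (subsets N) (h u) ≤ ∑ (subsets N) (h′ u)
        h≤h′-sum u = begin
          ∑ (subsets N) (h u)                   ≤⟨ ∑-mono (subsets N) (h≤h′ u) ⟩
          ∑ (subsets N) (h′ u ∘ flip v ∘ flip u) ≡⟨ ∑-flip u (h′ u ∘ flip v) ⟩
          ∑ (subsets N) (h′ u ∘ flip v)          ≡⟨ ∑-flip v (h′ u) ⟩
          ∑ (subsets N) (h′ u)                   ∎
          where open ≤-Reasoning

      -- Double counting: a pair (S, u) for which u is the only element of S near v goes to (S - u +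
      -- v, u). For a fixed T containing v, the u occurring in pairs (T, u) form a clique, so there
      -- are at most ω of them.
      singly-met : ∀ {ω} → CliquesBoundedBy ω a →
        ∑[ S ∈ maxima ] (meets v S * one (meets v S)) ≤ cover v * ω
      singly-met {ω} clique≤ω = begin
        ∑[ S ∈ maxima ] (meets v S * one (meets v S))
          ≡⟨ ∑-cong maxima (λ S → ≡-sym (trans
               (∑-cong Vertices (λ u → ≡-sym (*-assoc ⟦ R v u ⟧ _ _)))
               (∑-*ʳ Vertices (one (meets v S))))) ⟩
        ∑[ S ∈ maxima ] (∑[ u ∈ Vertices ] ⟦ R v u ⟧ * (⟦ lookup S u ⟧ * one (meets v S)))
          ≡⟨ ∑-swap maxima Vertices ⟩
        ∑[ u ∈ Vertices ] (∑[ S ∈ maxima ] ⟦ R v u ⟧ * (⟦ lookup S u ⟧ * one (meets v S)))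
          ≡⟨ ∑-cong Vertices (λ u → ∑-filter maximum? (subsets N) _) ⟩
        ∑[ u ∈ Vertices ] ∑ (subsets N) (h u)
          ≤⟨ ∑-mono Vertices h≤h′-sum ⟩
        ∑[ u ∈ Vertices ] ∑ (subsets N) (h′ u)
          ≡⟨ ∑-cong Vertices (λ u → ≡-sym (∑-filter maximum? (subsets N) _)) ⟩
        ∑[ u ∈ Vertices ] (∑[ T ∈ maxima ] ⟦ lookup T v ⟧ * ⟦ R v u ∧ mx (exchange⁻ u T) ⟧)
          ≡⟨ ∑-swap Vertices maxima ⟩
        ∑[ T ∈ maxima ] (∑[ u ∈ Vertices ] ⟦ lookup T v ⟧ * ⟦ R v u ∧ mx (exchange⁻ u T) ⟧)
          ≡⟨ ∑-cong maxima (λ T → ∑-*ˡ Vertices ⟦ lookup T v ⟧) ⟩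
        ∑[ T ∈ maxima ] ⟦ lookup T v ⟧ * (∑[ u ∈ Vertices ] ⟦ R v u ∧ mx (exchange⁻ u T) ⟧)
          ≤⟨ ∑-mono-∈ maxima bound ⟩
        ∑[ T ∈ maxima ] ⟦ lookup T v ⟧ * ω
          ≡⟨ ∑-*ʳ maxima ω ⟩
        cover v * ω ∎
        where
        open ≤-Reasoning
        both : ∀ {x y} → x ∧ y ≡ true → x ≡ true × y ≡ true
        both {true} {true} _ = refl , refl
        bound : ∀ {T} → T ∈ maxima →
          ⟦ lookup T v ⟧ * (∑[ u ∈ Vertices ] ⟦ R v u ∧ mx (exchange⁻ u T) ⟧) ≤ ⟦ lookup T v ⟧ * ω
        bound {T} T∈ with lookup T v in v∈T
        ... | false = z≤n
        ... | true  = *-monoʳ-≤ 1 (clique≤ω (λ u → R v u ∧ mx (exchange⁻ u T)) inside clique)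
          where
          max⁻ : ∀ u → mx (exchange⁻ u T) ≡ true → Maximum (exchange⁻ u T)
          max⁻ u = dec-true⁻ (maximum? (exchange⁻ u T))
          T-max : Maximum T
          T-max = ∈-maxima⁻ T∈
          inside : ∀ u → R v u ∧ mx (exchange⁻ u T) ≡ true → a u ≡ true
          inside u q with Rvu , e ← both q | u ≟ v
          ... | yes refl = av
          ... | no  u≢v  = within (maximum-stable (max⁻ u e)) u (flip-∋ u (flip v T) (trans (flip-≢ v T u≢v)
            (¬-not (λ u∈T → u≢v (≡-sym (independent (maximum-stable T-max) v u v∈T u∈T Rvu))))))
          clique : ∀ i j → R v i ∧ mx (exchange⁻ i T) ≡ true →
                   R v j ∧ mx (exchange⁻ j T) ≡ true → R i j ≡ true
          clique i j qi qj with R₁ , e₁ ← both qi | R₂ , e₂ ← both qj =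
            exchangeable-clique T-max v∈T i j R₁ (max⁻ i e₁) R₂ (max⁻ j e₂)

      -- Divided by `length maxima`, this is the inequality on expectations for a uniformly random
      -- maximum stable set; the first sum on the right counts the elements met by all the sets.
      cover-bound : ∀ {ω} → CliquesBoundedBy ω a →
        2 * length maxima ≤ (∑[ u ∈ Vertices ] ⟦ R v u ⟧ * cover u) + ω * cover v
      cover-bound {ω} clique≤ω = begin
        2 * length maxima               ≡⟨ *-comm 2 (length maxima) ⟩
        length maxima * 2               ≡⟨ ∑-const maxima 2 ⟨
        ∑[ S ∈ maxima ] 2
          ≤⟨ ∑-mono-∈ maxima (λ S∈ → k+k*one≥2 (meets≥1 (∈-maxima⁻ S∈))) ⟩
        ∑[ S ∈ maxima ] (meets v S + meets v S * one (meets v S))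
          ≡⟨ ∑-+ maxima ⟩
        ∑ maxima (meets v) + (∑[ S ∈ maxima ] meets v S * one (meets v S))
          ≤⟨ +-mono-≤ (≤-reflexive swapped)
               (≤-trans (singly-met clique≤ω) (≤-reflexive (*-comm (cover v) ω))) ⟩
        (∑[ u ∈ Vertices ] ⟦ R v u ⟧ * cover u) + ω * cover v ∎
        where
        open ≤-Reasoning
        swapped : ∑ maxima (meets v) ≡ ∑[ u ∈ Vertices ] ⟦ R v u ⟧ * cover u
        swapped = trans (∑-swap maxima Vertices)
                        (∑-cong Vertices (λ u → ∑-*ˡ maxima ⟦ R v u ⟧))

  -- Stable sets with multiplicities

  covered : List (Subset N × ℕ) → Fin N → ℕ
  covered es v = ∑[ e ∈ es ] ⟦ lookup (proj₁ e) v ⟧ * proj₂ e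

  total : List (Subset N × ℕ) → ℕ
  total es = ∑ es proj₂

  -- Multiplying by `k` refines the common denominator, so that the new sets can receive a fraction
  -- of the old unit.
  extend : ℕ → ℕ → List (Subset N) → List (Subset N × ℕ) → List (Subset N × ℕ)
  extend k r Ss es = map (λ e → proj₁ e , k * proj₂ e) es ++ map (_, r) Ss

  covered-extend : ∀ k r Ss es v → covered (extend k r Ss es) v ≡
    k * covered es v + r * (∑[ S ∈ Ss ] ⟦ lookup S v ⟧)
  covered-extend k r Ss es v = begin
    covered (extend k r Ss es) v
      ≡⟨ ∑-++ (map _ es) (map (_, r) Ss) _ ⟩
    covered (map (λ e → proj₁ e , k * proj₂ e) es) v + covered (map (_, r) Ss) v
      ≡⟨ cong₂ _+_ (∑-map _ es _) (∑-map (_, r) Ss _) ⟩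
    (∑[ e ∈ es ] ⟦ lookup (proj₁ e) v ⟧ * (k * proj₂ e)) + (∑[ S ∈ Ss ] ⟦ lookup S v ⟧ * r)
      ≡⟨ cong₂ _+_ (trans (∑-cong es (λ e → *-left-comm ⟦ lookup (proj₁ e) v ⟧ k (proj₂ e))) (∑-*ˡ es k))
                   (trans (∑-*ʳ Ss r) (*-comm _ r)) ⟩
    k * covered es v + r * (∑[ S ∈ Ss ] ⟦ lookup S v ⟧) ∎
    where
    open ≡-Reasoning
    *-left-comm : ∀ a b c → a * (b * c) ≡ b * (a * c)
    *-left-comm = solve-∀

  total-extend : ∀ k r Ss es → total (extend k r Ss es) ≡ k * total es + r * length Ss
  total-extend k r Ss es = begin
    total (extend k r Ss es)
      ≡⟨ ∑-++ (map _ es) (map (_, r) Ss) proj₂ ⟩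
    total (map (λ e → proj₁ e , k * proj₂ e) es) + total (map (_, r) Ss)
      ≡⟨ cong₂ _+_ (trans (∑-map _ es proj₂) (∑-*ˡ es k)) (∑-map (_, r) Ss proj₂) ⟩
    k * total es + (∑[ S ∈ Ss ] r)
      ≡⟨ cong₂ _+_ (refl {x = k * total es}) (trans (∑-const Ss r) (*-comm (length Ss) r)) ⟩
    k * total es + r * length Ss ∎
    where open ≡-Reasoning

  nearby : (Fin N → ℕ) → Fin N → ℕ
  nearby f v = ∑[ u ∈ Vertices ] ⟦ R v u ⟧ * f u

  nearby-cong : ∀ {f g} → (∀ u → f u ≡ g u) → ∀ v → nearby f v ≡ nearby g v
  nearby-cong eq v = ∑-cong Vertices (λ u → cong (⟦ R v u ⟧ *_) (eq u))

  nearby-linear : ∀ k r f g v → nearby (λ u → k * f u + r * g u) v ≡ k * nearby f v + r * nearby g v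
  nearby-linear k r f g v = begin
    nearby (λ u → k * f u + r * g u) v
      ≡⟨ ∑-cong Vertices (λ u → expand ⟦ R v u ⟧ k (f u) r (g u)) ⟩
    (∑[ u ∈ Vertices ] (k * (⟦ R v u ⟧ * f u) + r * (⟦ R v u ⟧ * g u)))
      ≡⟨ ∑-+ Vertices ⟩
    (∑[ u ∈ Vertices ] k * (⟦ R v u ⟧ * f u)) + (∑[ u ∈ Vertices ] r * (⟦ R v u ⟧ * g u))
      ≡⟨ cong₂ _+_ (∑-*ˡ Vertices k) (∑-*ˡ Vertices r) ⟩
    k * nearby f v + r * nearby g v ∎
    where
    open ≡-Reasoning
    expand : ∀ x k a r b → x * (k * a + r * b) ≡ k * (x * a) + r * (x * b)
    expand = solve-∀

  -- Growing a fractional colouring until every vertex is saturated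

  module _ (A : Fin N → Bool) {d ω : ℕ}
           (degree≤d : ∀ v → A v ≡ true → ∑[ u ∈ Vertices ] ⟦ R v u ∧ A u ⟧ ≤ d)
           (clique≤ω : CliquesBoundedBy ω A) where

    unsaturated : List (Subset N × ℕ) → ℕ → Fin N → Bool
    unsaturated es L v = A v ∧ does (covered es v <? L)

    unsaturated⁻ : ∀ es L {v} → unsaturated es L v ≡ true → A v ≡ true × covered es v < L
    unsaturated⁻ es L {v} eq with A v
    ... | true = refl , dec-true⁻ (covered es v <? L) eq

    unsaturated⁺ : ∀ es L {v} → A v ≡ true → covered es v < L → unsaturated es L v ≡ true
    unsaturated⁺ es L {v} Av lt rewrite Av = dec-true (covered es v <? L) lt

    -- Multiplicities are weights scaled by the common denominator level, so that a
    -- vertex is saturated when it is covered level many times.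
    record Partial : Set where
      field
        entries : List (Subset N × ℕ)
        level   : ℕ
        level>0 : 0 < level
        stables : ∀ {e} → e ∈ entries → Stable A (proj₁ e)
        covered≤level : ∀ v → covered entries v ≤ level
        -- `local` accumulates `cover-bound` over the steps taken so far. As it speaks of
        -- unsaturated vertices only, `global` preserves its consequence for when none is left.
        local  : ∀ v → unsaturated entries level v ≡ true →
                 2 * total entries ≤ nearby (covered entries) v + ω * covered entries v
        global : 2 * total entries ≤ (d + ω) * level
    open Partial

    covered-outside : ∀ es → (∀ {e} → e ∈ es → Stable A (proj₁ e)) →
                      ∀ v → A v ≡ false → covered es v ≡ 0
    covered-outside es st v Av = n≤0⇒n≡0 (≤-trans
      (∑-mono-∈ {g = λ _ → 0} es (λ {e} e∈ → ⟦⟧*-≤ (lookup (proj₁ e) v) (λ v∈ →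
        contradiction (trans (≡-sym Av) (within (st e∈) v v∈)) λ ())))
      (≤-reflexive (∑-zero es)))

    -- Vertices outside A are never covered, so at most d vertices contribute to `nearby`, each at
    -- most L.
    local⇒global : ∀ es L → (∀ {e} → e ∈ es → Stable A (proj₁ e)) → (∀ v → covered es v ≤ L) →
      ∀ v → A v ≡ true → 2 * total es ≤ nearby (covered es) v + ω * covered es v →
      2 * total es ≤ (d + ω) * L
    local⇒global es L st cov≤ v Av loc = begin
      2 * total es                                         ≤⟨ loc ⟩
      nearby (covered es) v + ω * covered es v
        ≤⟨ +-mono-≤ (∑-mono Vertices restrict) (*-monoʳ-≤ ω (cov≤ v)) ⟩
      (∑[ u ∈ Vertices ] ⟦ R v u ∧ A u ⟧ * L) + ω * L      ≡⟨ cong (_+ ω * L) (∑-*ʳ Vertices L) ⟩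
      (∑[ u ∈ Vertices ] ⟦ R v u ∧ A u ⟧) * L + ω * L
        ≤⟨ +-monoˡ-≤ (ω * L) (*-monoˡ-≤ L (degree≤d v Av)) ⟩
      d * L + ω * L                                        ≡⟨ *-distribʳ-+ L d ω ⟨
      (d + ω) * L                                          ∎
      where
      open ≤-Reasoning
      restrict : ∀ u → ⟦ R v u ⟧ * covered es u ≤ ⟦ R v u ∧ A u ⟧ * L
      restrict u with R v u | A u in Au
      ... | false | _     = z≤n
      ... | true  | true  = *-monoʳ-≤ 1 (cov≤ u)
      ... | true  | false = ≤-reflexive (cong (1 *_) (covered-outside es st u Au))

    unsaturatedCount : Partial → ℕ
    unsaturatedCount p = ∑[ v ∈ Vertices ] ⟦ unsaturated (entries p) (level p) v ⟧

    -- The first vertex saturated when all maximum stable sets gain weight uniformly is the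
    -- w minimising deficit w / cover w; scaling by cover w keeps the multiplicities integral.
    saturate : ∀ p v₀ → unsaturated (entries p) (level p) v₀ ≡ true →
               ∃ λ p′ → unsaturatedCount p′ < unsaturatedCount p
    saturate p v₀ v₀-unsat = result (min-ratio deficit cover Vertices)
      where
      es = entries p
      L  = level p
      a : Fin N → Bool
      a = unsaturated es L
      open MaximumStable a
      deficit : Fin N → ℕ
      deficit v = L ∸ covered es v

      bound : ∀ v → a v ≡ true → 2 * length maxima ≤ nearby cover v + ω * cover v
      bound v av = cover-bound av (λ Q Q⊆a → clique≤ω Q (λ i → proj₁ ∘ unsaturated⁻ es L ∘ Q⊆a i))

      module _ (w : Fin N) (cw>0 : 0 < cover w)
               (min : ∀ v → deficit w * cover v ≤ deficit v * cover w) where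

        k r L′ : ℕ
        k  = cover w
        r  = deficit w
        L′ = k * L
        es′ : List (Subset N × ℕ)
        es′ = extend k r maxima es

        stables′ : ∀ {e} → e ∈ es′ → Stable A (proj₁ e)
        stables′ e∈ with ∈-++⁻ (map (λ e → proj₁ e , k * proj₂ e) es) e∈
        ... | inj₁ e∈ˡ with _ , e₀∈ , refl ← ∈-map⁻ _ e∈ˡ = stables p e₀∈
        ... | inj₂ e∈ʳ with S , S∈ , refl ← ∈-map⁻ _ e∈ʳ =
          mkStable (λ i → proj₁ ∘ unsaturated⁻ es L ∘ within st i) (independent st)
          where st = maximum-stable (∈-maxima⁻ S∈)

        covered′ : ∀ v → covered es′ v ≡ k * covered es v + r * cover v
        covered′ = covered-extend k r maxima es

        -- An increase by `deficit v * k` would bring v exactly to the new level. By the choice of w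
        -- the actual increase `r * cover v` is at most that, with equality at v = w.
        fill : ∀ v → k * covered es v + deficit v * k ≡ L′
        fill v = trans (cong₂ _+_ (refl {x = k * covered es v}) (*-comm (deficit v) k))
          (trans (≡-sym (*-distribˡ-+ k (covered es v) (deficit v)))
                 (cong (k *_) (m+[n∸m]≡n (covered≤level p v))))

        covered≤L′ : ∀ v → covered es′ v ≤ L′
        covered≤L′ v = ≤-trans (≤-reflexive (covered′ v))
          (≤-trans (+-monoʳ-≤ (k * covered es v) (min v)) (≤-reflexive (fill v)))

        L′≤covered : ∀ v → A v ≡ true → a v ≡ false → L′ ≤ covered es′ v
        L′≤covered v Av av = ≤-trans
          (*-monoʳ-≤ k (≮⇒≥ (λ lt → contradiction (trans (≡-sym av) (unsaturated⁺ es L Av lt)) λ ())))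
          (≤-trans (m≤m+n (k * covered es v) (r * cover v)) (≤-reflexive (≡-sym (covered′ v))))

        -- Level and old coverage are scaled by the same factor, so a saturated vertex stays
        -- saturated. Hence `local` has to be checked only where it held before the step.
        still-unsaturated : ∀ v → unsaturated es′ L′ v ≡ true → a v ≡ true
        still-unsaturated v eq with Av , lt ← unsaturated⁻ es′ L′ eq | a v in av
        ... | true  = refl
        ... | false = contradiction (L′≤covered v Av av) (<⇒≱ lt)

        local′ : ∀ v → a v ≡ true → 2 * total es′ ≤ nearby (covered es′) v + ω * covered es′ v
        local′ v av = begin
          2 * total es′
            ≡⟨ cong (2 *_) (total-extend k r maxima es) ⟩
          2 * (k * total es + r * length maxima)
            ≡⟨ expand 2 k (total es) r (length maxima) ⟩
          k * (2 * total es) + r * (2 * length maxima)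
            ≤⟨ +-mono-≤ (*-monoʳ-≤ k (local p v av)) (*-monoʳ-≤ r (bound v av)) ⟩
          k * (nearby (covered es) v + ω * covered es v) + r * (nearby cover v + ω * cover v)
            ≡⟨ regroup k r ω (nearby (covered es) v) (covered es v) (nearby cover v) (cover v) ⟩
          (k * nearby (covered es) v + r * nearby cover v) + ω * (k * covered es v + r * cover v)
            ≡⟨ cong₂ _+_ (≡-sym (trans (nearby-cong covered′ v)
                                       (nearby-linear k r (covered es) cover v)))
                         (cong (ω *_) (≡-sym (covered′ v))) ⟩
          nearby (covered es′) v + ω * covered es′ v ∎
          where
          open ≤-Reasoning
          expand : ∀ x k a r b → x * (k * a + r * b) ≡ k * (x * a) + r * (x * b)
          expand = solve-∀
          regroup : ∀ k r ω a b c d →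
            k * (a + ω * b) + r * (c + ω * d) ≡ (k * a + r * c) + ω * (k * b + r * d)
          regroup = solve-∀

        next : Partial
        next = record
          { entries = es′
          ; level   = L′
          ; level>0 = *-mono-≤ cw>0 (level>0 p)
          ; stables = stables′
          ; covered≤level = covered≤L′
          ; local   = λ v → local′ v ∘ still-unsaturated v
          -- `v₀` was unsaturated before the step, so `local′` holds there even if this very step
          -- saturates it.
          ; global  = local⇒global es′ L′ stables′ covered≤L′ v₀ (proj₁ (unsaturated⁻ es L v₀-unsat))
                                   (local′ v₀ v₀-unsat)
          }

        w-unsat : a w ≡ true
        w-unsat with a w in aw
        ... | true  = refl
        ... | false = contradiction (cover-outside w aw) (>⇒≢ cw>0)

        w-saturated : unsaturated es′ L′ w ≡ false
        w-saturated = ¬-not (λ eq → <-irrefl (trans (covered′ w) (fill w)) (proj₂ (unsaturated⁻ es′ L′ eq)))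

        fewer : unsaturatedCount next < unsaturatedCount p
        fewer = ∑-mono-< (∈-allFin w)
          (λ v → ⟦⟧-mono (unsaturated es′ L′ v) (λ eq →
             ≤-reflexive (cong ⟦_⟧ (≡-sym (still-unsaturated v eq)))))
          (≤-reflexive (trans (cong (suc ∘ ⟦_⟧) w-saturated) (cong ⟦_⟧ (≡-sym w-unsat))))

      result : (∀ {v} → v ∈ Vertices → cover v ≡ 0) ⊎
               (∃ λ w → 0 < cover w ×
                        (∀ {v} → v ∈ Vertices → deficit w * cover v ≤ deficit v * cover w)) →
               ∃ λ p′ → unsaturatedCount p′ < unsaturatedCount p
      result (inj₂ (w , cw>0 , min)) = next w cw>0 (λ v → min (∈-allFin v)) ,
                                       fewer w cw>0 (λ v → min (∈-allFin v))
      -- If no vertex were covered, `bound` at `v₀` would leave no maximum stable set at all.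
      result (inj₁ none) = contradiction maxima-nonempty (<⇒≱ (s≤s (*-cancelˡ-≤ 2 (begin
        2 * length maxima                ≤⟨ bound v₀ v₀-unsat ⟩
        nearby cover v₀ + ω * cover v₀
          ≡⟨ cong₂ _+_ (nearby-cong (λ u → none (∈-allFin u)) v₀) (cong (ω *_) (none (∈-allFin v₀))) ⟩
        nearby (λ _ → 0) v₀ + ω * 0
          ≡⟨ cong₂ _+_ (trans (∑-*ʳ Vertices 0) (*-zeroʳ (∑ Vertices (λ u → ⟦ R v₀ u ⟧)))) (*-zeroʳ ω) ⟩
        0                                ∎))))
        where open ≤-Reasoning

    start : Partial
    start = record
      { entries = []
      ; level   = 1
      ; level>0 = s≤s z≤n
      ; stables = λ ()
      ; covered≤level = λ _ → z≤n
      ; local   = λ _ _ → z≤n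
      ; global  = z≤n
      }

    saturate-all : ∃ λ p → ∀ v → unsaturated (entries p) (level p) v ≡ false
    saturate-all = go (unsaturatedCount start) start ≤-refl
      where
      go : ∀ k p → unsaturatedCount p ≤ k → ∃ λ p → ∀ v → unsaturated (entries p) (level p) v ≡ false
      go k p ≤k with any? (λ v → unsaturated (entries p) (level p) v ≟ᵇ true)
      ... | no none = p , λ v → ¬-not (λ eq → none (v , eq))
      ... | yes (v , eq) with saturate p v eq
      go zero    p ≤k | yes _ | p′ , lt = contradiction (<-≤-trans lt ≤k) λ ()
      go (suc k) p ≤k | yes _ | p′ , lt = go k p′ (≤-pred (<-≤-trans lt ≤k))

    fractional-colouring : ∃ λ es → ∃ λ L → 0 < L ×
      (∀ {e} → e ∈ es → Stable A (proj₁ e)) ×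
      (∀ v → A v ≡ true → covered es v ≡ L) ×
      2 * total es ≤ (d + ω) * L
    fractional-colouring with p , none ← saturate-all =
      entries p , level p , level>0 p , stables p , saturated , global p
      where
      saturated : ∀ v → A v ≡ true → covered (entries p) v ≡ level p
      saturated v Av = ≤-antisym (covered≤level p v)
        (≮⇒≥ (λ lt → contradiction (trans (≡-sym (none v)) (unsaturated⁺ (entries p) (level p) Av lt)) λ ()))

-- Cliques in the square of the line graph

2ab≤a²+b² : ∀ a b → 2 * (a * b) ≤ a * a + b * b
2ab≤a²+b² a b with ≤-total a b
... | inj₁ a≤b with k , refl ← m≤n⇒∃[o]m+o≡n a≤b =
  ≤-trans (m≤m+n _ (k * k)) (≤-reflexive (expand a k))
  where
  expand : ∀ a k → 2 * (a * (a + k)) + k * k ≡ a * a + (a + k) * (a + k)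
  expand = solve-∀
... | inj₂ b≤a with k , refl ← m≤n⇒∃[o]m+o≡n b≤a =
  ≤-trans (m≤m+n _ (k * k)) (≤-reflexive (expand b k))
  where
  expand : ∀ b k → 2 * ((b + k) * b) + k * k ≡ (b + k) * (b + k) + b * b
  expand = solve-∀

-- 2D times the fraction of an edge charged to an endpoint that has p of its D possible
-- neighbours: p/D ↦ 2p/D − 1/2, clamped to [0, 1].
charge : ℕ → ℕ → ℕ
charge D p = 2 * D ⊓ (4 * p ∸ D)

-- Unless one of the charges is already 2D, they are at least 4p - D and 4q - D, whose sum 4(p + q)
-- - 2D is at least 2D.
charge-covers : ∀ D p q → D ≤ p + q → 2 * D ≤ charge D p + charge D q
charge-covers D p q D≤ with ⊓-sel (2 * D) (4 * p ∸ D) | ⊓-sel (2 * D) (4 * q ∸ D)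
... | inj₁ eq | _       = ≤-trans (≤-reflexive (≡-sym eq)) (m≤m+n _ _)
... | inj₂ _  | inj₁ eq = ≤-trans (≤-reflexive (≡-sym eq)) (m≤n+m _ (charge D p))
... | inj₂ eqp | inj₂ eqq rewrite eqp | eqq = +-cancelˡ-≤ (2 * D) _ _ (begin
  2 * D + 2 * D                           ≡⟨ double D ⟩
  4 * D                                   ≤⟨ *-monoʳ-≤ 4 D≤ ⟩
  4 * (p + q)                             ≡⟨ *-distribˡ-+ 4 p q ⟩
  4 * p + 4 * q
    ≤⟨ +-mono-≤ (m≤n+m∸n (4 * p) D) (m≤n+m∸n (4 * q) D) ⟩
  (D + (4 * p ∸ D)) + (D + (4 * q ∸ D))   ≡⟨ regroup D (4 * p ∸ D) (4 * q ∸ D) ⟩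
  2 * D + ((4 * p ∸ D) + (4 * q ∸ D))     ∎)
  where
  open ≤-Reasoning
  double : ∀ D → 2 * D + 2 * D ≡ 4 * D
  double = solve-∀
  regroup : ∀ D a b → (D + a) + (D + b) ≡ 2 * D + (a + b)
  regroup = solve-∀

-- With D = p + s, a nonzero charge is at most 3p - s, and (p + s)p - (3p - s)s = (p - s)².
charge-slack : ∀ p s → charge (p + s) p * s ≤ (p + s) * p
charge-slack p s with ≤-total (p + s) (4 * p)
... | inj₂ 4p≤ = ≤-trans (≤-reflexive (cong (_* s) (n≤0⇒n≡0
        (≤-trans (m⊓n≤n (2 * (p + s)) _) (≤-reflexive (m≤n⇒m∸n≡0 4p≤)))))) z≤n
... | inj₁ ≤4p = +-cancelʳ-≤ (s * s) _ _ (begin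
  g * s + s * s             ≡⟨ *-distribʳ-+ s g s ⟨
  (g + s) * s               ≤⟨ *-monoˡ-≤ s g+s≤3p ⟩
  3 * p * s                 ≡⟨ split p s ⟩
  2 * (p * s) + p * s       ≤⟨ +-monoˡ-≤ (p * s) (2ab≤a²+b² p s) ⟩
  (p * p + s * s) + p * s   ≡⟨ regroup p s ⟩
  (p + s) * p + s * s       ∎)
  where
  open ≤-Reasoning
  g : ℕ
  g = charge (p + s) p
  split : ∀ p s → 3 * p * s ≡ 2 * (p * s) + p * s
  split = solve-∀
  regroup : ∀ p s → (p * p + s * s) + p * s ≡ (p + s) * p + s * s
  regroup = solve-∀
  g+s≤3p : g + s ≤ 3 * p
  g+s≤3p = +-cancelʳ-≤ p _ _ (begin
    g + s + p     ≡⟨ +-assoc g s p ⟩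
    g + (s + p)   ≡⟨ cong₂ _+_ (refl {x = g}) (+-comm s p) ⟩
    g + (p + s)   ≤⟨ +-monoˡ-≤ (p + s) (m⊓n≤n (2 * (p + s)) _) ⟩
    4 * p ∸ (p + s) + (p + s) ≡⟨ m∸n+n≡m ≤4p ⟩
    4 * p         ≡⟨ +-comm p (3 * p) ⟩
    3 * p + p     ∎)

-- This is the bound 3p/2 on what a vertex pays, scaled by 2D: it pays its charge on F edges and the
-- full price on f edges. Under the constraints the worst case is f = p and F = D - p.
charge-cost : ∀ D p F f → F + f ≤ D → f ≤ p → p ≤ D → F * charge D p + 2 * D * f ≤ 3 * D * p
charge-cost D p F f F+f≤D f≤p p≤D with s , refl ← m≤n⇒∃[o]m+o≡n p≤D
  -- `H` is the complement 2D - g; writing 2D as g + H exposes a nonnegative combination of F + f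
  -- and f.
  with H , g+H≡2D ← m≤n⇒∃[o]m+o≡n (m⊓n≤m (2 * (p + s)) (4 * p ∸ (p + s))) = begin
  F * g + 2 * (p + s) * f   ≡⟨ cong (λ x → F * g + x * f) g+H≡2D ⟨
  F * g + (g + H) * f       ≡⟨ collect F f g H ⟩
  g * (F + f) + H * f       ≤⟨ +-mono-≤ (*-monoʳ-≤ g F+f≤D) (*-monoʳ-≤ H f≤p) ⟩
  g * (p + s) + H * p       ≡⟨ regroup g p s H ⟩
  g * s + (g + H) * p       ≡⟨ cong (λ x → g * s + x * p) g+H≡2D ⟩
  g * s + 2 * (p + s) * p   ≤⟨ +-monoˡ-≤ (2 * (p + s) * p) (charge-slack p s) ⟩
  (p + s) * p + 2 * (p + s) * p ≡⟨ triple p s ⟩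
  3 * (p + s) * p           ∎
  where
  open ≤-Reasoning
  g : ℕ
  g = charge (p + s) p
  collect : ∀ F f g H → F * g + (g + H) * f ≡ g * (F + f) + H * f
  collect = solve-∀
  regroup : ∀ g p s H → g * (p + s) + H * p ≡ g * s + (g + H) * p
  regroup = solve-∀
  triple : ∀ p s → (p + s) * p + 2 * (p + s) * p ≡ 3 * (p + s) * p
  triple = solve-∀

∈⇒≤foldr-⊔ : ∀ {k ks} → k ∈ ks → k ≤ foldr _⊔_ 0 ks
∈⇒≤foldr-⊔ {ks = k ∷ ks} (here refl) = m≤m⊔n k _
∈⇒≤foldr-⊔ {ks = l ∷ ks} (there k∈)  = ≤-trans (∈⇒≤foldr-⊔ k∈) (m≤n⊔m l _)

-- Degrees and touching edges

module _ {n : ℕ} (G : Graph n) where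

  private
    Δ : ℕ
    Δ = maxDegree G

    V : List (Fin n)
    V = allFin n

  ∑adj≤maxDegree : ∀ v → ∑[ u ∈ V ] ⟦ adj G v u ⟧ ≤ maxDegree G
  ∑adj≤maxDegree v = ≤-trans (≤-reflexive (≡-sym degree≡∑))
    (∈⇒≤foldr-⊔ (∈-map⁺ (degree G) (∈-allFin v)))
    where
    adj? : ∀ u → Dec (adj G v u ≡ true)
    adj? u = adj G v u ≟ᵇ true
    does-≟true : ∀ b → ⟦ does (b ≟ᵇ true) ⟧ * 1 ≡ ⟦ b ⟧
    does-≟true true  = refl
    does-≟true false = refl
    degree≡∑ : degree G v ≡ ∑[ u ∈ V ] ⟦ adj G v u ⟧
    degree≡∑ = trans (≡-sym (trans (∑-const (filter adj? V) 1) (*-identityʳ _)))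
      (trans (∑-filter adj? V (λ _ → 1)) (∑-cong V (λ u → does-≟true (adj G v u))))

  near : Fin n → Fin n → Bool
  near u x = does (u ≟ x) ∨ adj G u x

  near⁻ : ∀ {u x} → near u x ≡ true → u ≡ x ⊎ adj G u x ≡ true
  near⁻ {u} {x} eq with u ≟ x
  ... | yes u≡x = inj₁ u≡x
  ... | no  _   = inj₂ eq

  -- The equality case of `near` accounts for common endpoints, and thereby for equal edges.
  touch : Fin n → Fin n → Fin n → Fin n → Bool
  touch u v x y = (near u x ∨ near u y) ∨ (near v x ∨ near v y)

  touch⁻ : ∀ {u v x y} → touch u v x y ≡ true →
    (near u x ≡ true ⊎ near u y ≡ true) ⊎ (near v x ≡ true ⊎ near v y ≡ true)
  touch⁻ {u} {v} {x} {y} eq with ∨⁻ (near u x ∨ near u y) eq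
  ... | inj₁ eq′ = inj₁ (∨⁻ (near u x) eq′)
  ... | inj₂ eq′ = inj₂ (∨⁻ (near v x) eq′)

  -- Counting the edges of a clique of touching edges

  module StrongClique (c : Fin n → Fin n → Bool) (c-sym : ∀ x y → c x y ≡ c y x)
    (c⊆adj : ∀ x y → c x y ≡ true → adj G x y ≡ true)
    (c-touch : ∀ u v x y → c u v ≡ true → c x y ≡ true → touch u v x y ≡ true) where

    cdeg : Fin n → ℕ
    cdeg x = ∑[ y ∈ V ] ⟦ c x y ⟧

    ⟦c⟧≤⟦adj⟧ : ∀ x y → ⟦ c x y ⟧ ≤ ⟦ adj G x y ⟧
    ⟦c⟧≤⟦adj⟧ x y = ⟦⟧-mono (c x y) (λ cxy → ≤-reflexive (cong ⟦_⟧ (≡-sym (c⊆adj x y cxy))))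

    module _ (v : Fin n) (cdeg>0 : 0 < cdeg v) (cdeg≤ : ∀ x → cdeg x ≤ cdeg v) where

      D : ℕ
      D = cdeg v

      -- The three kinds of vertices as seen from v: non-neighbours (v itself among them), the set U
      -- of clique-neighbours, and the other neighbours.
      far via by : Fin n → ℕ
      far x = ⟦ not (adj G v x) ⟧
      via x = ⟦ c v x ⟧
      by  x = ⟦ adj G v x ∧ not (c v x) ⟧

      trichotomy : ∀ x → far x + via x + by x ≡ 1
      trichotomy x with adj G v x in Avx | c v x in cvx
      ... | true  | true  = refl
      ... | true  | false = refl
      ... | false | false = refl
      ... | false | true  = contradiction (trans (≡-sym Avx) (c⊆adj v x cvx)) λ ()

      far+via≤1 : ∀ x → far x + via x ≤ 1
      far+via≤1 x = ≤-trans (m≤m+n _ (by x)) (≤-reflexive (trichotomy x))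

      -- Only `p` counts along all edges of the graph; `F`, `f` and `W` split the clique edges at x
      -- by the kind of their other end.
      p F f W : Fin n → ℕ
      p x = ∑[ y ∈ V ] via y * ⟦ adj G y x ⟧
      F x = ∑[ y ∈ V ] far y * ⟦ c x y ⟧
      f x = ∑[ y ∈ V ] via y * ⟦ c x y ⟧
      W x = ∑[ y ∈ V ] by  y * ⟦ c x y ⟧

      cdeg-split : ∀ x → cdeg x ≡ F x + f x + W x
      cdeg-split x = begin
        cdeg x
          ≡⟨ ∑-cong V (λ y → trans (≡-sym (*-identityˡ ⟦ c x y ⟧))
               (trans (cong (_* ⟦ c x y ⟧) (≡-sym (trichotomy y)))
                      (expand (far y) (via y) (by y) ⟦ c x y ⟧))) ⟩
        (∑[ y ∈ V ] (far y * ⟦ c x y ⟧ + via y * ⟦ c x y ⟧ + by y * ⟦ c x y ⟧))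
          ≡⟨ trans (∑-+ V) (cong (_+ W x) (∑-+ V)) ⟩
        F x + f x + W x ∎
        where
        open ≡-Reasoning
        expand : ∀ a b d e → (a + b + d) * e ≡ a * e + b * e + d * e
        expand = solve-∀

      F+f≤D : ∀ x → F x + f x ≤ D
      F+f≤D x = ≤-trans (m≤m+n _ (W x)) (≤-trans (≤-reflexive (≡-sym (cdeg-split x))) (cdeg≤ x))

      f≤p : ∀ x → f x ≤ p x
      f≤p x = ∑-mono V (λ y → *-monoʳ-≤ (via y)
        (≤-trans (≤-reflexive (cong ⟦_⟧ (c-sym x y))) (⟦c⟧≤⟦adj⟧ y x)))

      p≤D : ∀ x → p x ≤ D
      p≤D x = ∑-mono V (λ y →
        ≤-trans (*-monoʳ-≤ (via y) (⟦⟧≤1 (adj G y x))) (≤-reflexive (*-identityʳ (via y))))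

      not⁻ : ∀ {b} → not b ≡ true → b ≡ false
      not⁻ {false} _ = refl

      -- A clique edge xy far from v touches every clique edge vz, hence z is adjacent to x or y.
      D≤p+p : ∀ {x y} → adj G v x ≡ false → adj G v y ≡ false → c x y ≡ true → D ≤ p x + p y
      D≤p+p {x} {y} vx vy cxy = ≤-trans
        (∑-mono V (λ z → ⟦⟧-mono (c v z) (λ cvz → reached z cvz (c-touch v z x y cvz cxy))))
        (≤-reflexive (∑-+ V))
        where
        clash : ∀ {P : Set} {b} → b ≡ true → b ≡ false → P
        clash refl ()
        reached : ∀ z → c v z ≡ true → touch v z x y ≡ true →
          1 ≤ via z * ⟦ adj G z x ⟧ + via z * ⟦ adj G z y ⟧
        reached z cvz t with touch⁻ {v} {z} t
        ... | inj₁ (inj₁ v~x) with near⁻ v~x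
        ...   | inj₁ refl = clash (c⊆adj v y cxy) vy
        ...   | inj₂ Avx  = clash Avx vx
        reached z cvz t | inj₁ (inj₂ v~y) with near⁻ v~y
        ...   | inj₁ refl = clash (c⊆adj v x (trans (c-sym v x) cxy)) vx
        ...   | inj₂ Avy  = clash Avy vy
        reached z cvz t | inj₂ (inj₁ z~x) with near⁻ z~x
        ...   | inj₁ refl = clash (c⊆adj v z cvz) vx
        ...   | inj₂ Azx rewrite cvz | Azx = s≤s z≤n
        reached z cvz t | inj₂ (inj₂ z~y) with near⁻ z~y
        ...   | inj₁ refl = clash (c⊆adj v z cvz) vy
        ...   | inj₂ Azy rewrite cvz | Azy = m≤n+m 1 _

      g : Fin n → ℕ
      g x = charge D (p x)

      K : Fin n → Fin n → ℕ
      K x y = far x * (far y * ⟦ c x y ⟧)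

      K-sym : ∀ x y → K x y ≡ K y x
      K-sym x y = trans (cong (λ b → far x * (far y * ⟦ b ⟧)) (c-sym x y))
                        (swap (far x) (far y) ⟦ c y x ⟧)
        where
        swap : ∀ a b e → a * (b * e) ≡ b * (a * e)
        swap = solve-∀

      2D*K≤ : ∀ x y → 2 * D * K x y ≤ K x y * g x + K x y * g y
      2D*K≤ x y = begin
        2 * D * K x y         ≡⟨ *-comm (2 * D) (K x y) ⟩
        K x y * (2 * D)       ≡⟨ assoc (far x) (far y) ⟦ c x y ⟧ (2 * D) ⟩
        far x * (far y * (⟦ c x y ⟧ * (2 * D)))
          ≤⟨ ⟦⟧*-≤ (not (adj G v x)) (λ fx → ⟦⟧*-≤ (not (adj G v y)) (λ fy → ⟦⟧*-≤ (c x y) (λ cxy →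
               charged fx fy cxy))) ⟩
        K x y * (g x + g y)   ≡⟨ *-distribˡ-+ (K x y) (g x) (g y) ⟩
        K x y * g x + K x y * g y ∎
        where
        open ≤-Reasoning
        assoc : ∀ a b e k → a * (b * e) * k ≡ a * (b * (e * k))
        assoc = solve-∀
        charged : not (adj G v x) ≡ true → not (adj G v y) ≡ true → c x y ≡ true →
                  2 * D ≤ K x y * (g x + g y)
        charged fx fy cxy = ≤-trans
          (charge-covers D (p x) (p y) (D≤p+p (not⁻ fx) (not⁻ fy) cxy))
          (≤-reflexive (trans (≡-sym (*-identityˡ (g x + g y)))
            (cong (_* (g x + g y)) (≡-sym K≡1))))
          where
          K≡1 : K x y ≡ 1
          K≡1 rewrite fx | fy | cxy = refl

      -- Sum the inequality 2D ≤ g x + g y over the ordered far clique edges. By symmetry both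
      -- halves of the right side agree, and a factor 2 cancels.
      D*∑F≤ : D * (∑[ x ∈ V ] far x * F x) ≤ ∑[ x ∈ V ] far x * (F x * g x)
      D*∑F≤ = *-cancelˡ-≤ 2 (begin
        2 * (D * (∑[ x ∈ V ] far x * F x))       ≡⟨ *-assoc 2 D _ ⟨
        2 * D * (∑[ x ∈ V ] far x * F x)
          ≡⟨ cong (2 * D *_) (∑-cong V (λ x → ≡-sym (∑-*ˡ V (far x)))) ⟩
        2 * D * (∑[ x ∈ V ] ∑ V (K x))
          ≡⟨ trans (∑-cong V (λ x → ∑-*ˡ V (2 * D))) (∑-*ˡ V (2 * D)) ⟨
        (∑[ x ∈ V ] ∑[ y ∈ V ] 2 * D * K x y)    ≤⟨ ∑-mono V (λ x → ∑-mono V (2D*K≤ x)) ⟩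
        (∑[ x ∈ V ] ∑[ y ∈ V ] (K x y * g x + K x y * g y))
          ≡⟨ trans (∑-cong V (λ x → ∑-+ V)) (∑-+ V) ⟩
        (∑[ x ∈ V ] ∑[ y ∈ V ] K x y * g x) + (∑[ x ∈ V ] ∑[ y ∈ V ] K x y * g y)
          ≡⟨ cong₂ _+_ (refl {x = ∑[ x ∈ V ] ∑[ y ∈ V ] K x y * g x}) (trans (∑-swap V V)
               (∑-cong V (λ y → ∑-cong V (λ x → cong (_* g y) (K-sym x y))))) ⟩
        (∑[ x ∈ V ] ∑[ y ∈ V ] K x y * g x) + (∑[ x ∈ V ] ∑[ y ∈ V ] K x y * g x)
          ≡⟨ cong₂ _+_ collapse (trans collapse (≡-sym (+-identityʳ _))) ⟩
        2 * (∑[ x ∈ V ] far x * (F x * g x))     ∎)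
        where
        open ≤-Reasoning
        collapse : (∑[ x ∈ V ] ∑[ y ∈ V ] K x y * g x) ≡ ∑[ x ∈ V ] far x * (F x * g x)
        collapse = ∑-cong V (λ x → trans (∑-*ʳ V (g x))
          (trans (cong (_* g x) (∑-*ˡ V (far x))) (*-assoc (far x) (F x) (g x))))

      -- Edges between far vertices occur here from both ends, edges from far vertices to U from the
      -- far end with weight 2. `charge-cost` at each far vertex gives the bound after cancelling D.
      far-edges : (∑[ x ∈ V ] far x * F x) + 2 * (∑[ x ∈ V ] far x * f x)
                ≤ 3 * (∑[ x ∈ V ] far x * p x)
      far-edges = *-cancelˡ-≤ D {{>-nonZero cdeg>0}} (begin
        D * ((∑[ x ∈ V ] far x * F x) + 2 * (∑[ x ∈ V ] far x * f x))
          ≡⟨ expand D (∑[ x ∈ V ] far x * F x) (∑[ x ∈ V ] far x * f x) ⟩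
        D * (∑[ x ∈ V ] far x * F x) + 2 * D * (∑[ x ∈ V ] far x * f x)
          ≤⟨ +-mono-≤ D*∑F≤ (≤-reflexive (≡-sym (∑-*ˡ V (2 * D)))) ⟩
        (∑[ x ∈ V ] far x * (F x * g x)) + (∑[ x ∈ V ] 2 * D * (far x * f x))
          ≡⟨ ∑-+ V ⟨
        (∑[ x ∈ V ] (far x * (F x * g x) + 2 * D * (far x * f x)))
          ≤⟨ ∑-mono V pointwise ⟩
        (∑[ x ∈ V ] 3 * D * (far x * p x))       ≡⟨ ∑-*ˡ V (3 * D) ⟩
        3 * D * (∑[ x ∈ V ] far x * p x)         ≡⟨ rotate D (∑[ x ∈ V ] far x * p x) ⟩
        D * (3 * (∑[ x ∈ V ] far x * p x))       ∎)
        where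
        open ≤-Reasoning
        expand : ∀ D a b → D * (a + 2 * b) ≡ D * a + 2 * D * b
        expand = solve-∀
        rotate : ∀ D a → 3 * D * a ≡ D * (3 * a)
        rotate = solve-∀
        factor : ∀ o Fg D f → o * Fg + 2 * D * (o * f) ≡ o * (Fg + 2 * D * f)
        factor = solve-∀
        unfactor : ∀ o D p → o * (3 * D * p) ≡ 3 * D * (o * p)
        unfactor = solve-∀
        pointwise : ∀ x → far x * (F x * g x) + 2 * D * (far x * f x) ≤ 3 * D * (far x * p x)
        pointwise x = begin
          far x * (F x * g x) + 2 * D * (far x * f x)  ≡⟨ factor (far x) (F x * g x) D (f x) ⟩
          far x * (F x * g x + 2 * D * f x)
            ≤⟨ *-monoʳ-≤ (far x) (charge-cost D (p x) (F x) (f x) (F+f≤D x) (f≤p x) (p≤D x)) ⟩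
          far x * (3 * D * p x)                        ≡⟨ unfactor (far x) D (p x) ⟩
          3 * D * (far x * p x)                        ∎

      -- Counted from the other end, these are the edges leaving the D vertices of U.
      ∑p≤DΔ : ∑ V p ≤ D * Δ
      ∑p≤DΔ = begin
        ∑ V p                                                 ≡⟨ ∑-swap V V ⟩
        (∑[ y ∈ V ] ∑[ x ∈ V ] via y * ⟦ adj G y x ⟧)
          ≡⟨ ∑-cong V (λ y → ∑-*ˡ V (via y)) ⟩
        (∑[ y ∈ V ] via y * (∑[ x ∈ V ] ⟦ adj G y x ⟧))
          ≤⟨ ∑-mono V (λ y → *-monoʳ-≤ (via y) (∑adj≤maxDegree y)) ⟩
        (∑[ y ∈ V ] via y * Δ)                                ≡⟨ ∑-*ʳ V Δ ⟩
        D * Δ                                                 ∎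
        where open ≤-Reasoning

      D+∑by≤Δ : D + ∑ V by ≤ Δ
      D+∑by≤Δ = ≤-trans (≤-reflexive (≡-sym (∑-+ V)))
        (≤-trans (∑-mono V pointwise) (∑adj≤maxDegree v))
        where
        pointwise : ∀ x → via x + by x ≤ ⟦ adj G v x ⟧
        pointwise x with adj G v x in Avx | c v x in cvx
        ... | true  | true  = ≤-refl
        ... | true  | false = ≤-refl
        ... | false | false = ≤-refl
        ... | false | true  = contradiction (trans (≡-sym Avx) (c⊆adj v x cvx)) λ ()

      ∑by*cdeg≤ : ∑[ x ∈ V ] by x * cdeg x ≤ ∑ V by * D
      ∑by*cdeg≤ = ≤-trans (∑-mono V (λ x → *-monoʳ-≤ (by x) (cdeg≤ x))) (≤-reflexive (∑-*ʳ V D))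

      swap-ends : ∀ (h k : Fin n → ℕ) →
        (∑[ x ∈ V ] h x * (∑[ y ∈ V ] k y * ⟦ c x y ⟧)) ≡
        (∑[ y ∈ V ] k y * (∑[ x ∈ V ] h x * ⟦ c y x ⟧))
      swap-ends h k = begin
        (∑[ x ∈ V ] h x * (∑[ y ∈ V ] k y * ⟦ c x y ⟧))   ≡⟨ ∑-cong V (λ x → ∑-*ˡ V (h x)) ⟨
        (∑[ x ∈ V ] ∑[ y ∈ V ] h x * (k y * ⟦ c x y ⟧))   ≡⟨ ∑-swap V V ⟩
        (∑[ y ∈ V ] ∑[ x ∈ V ] h x * (k y * ⟦ c x y ⟧))
          ≡⟨ ∑-cong V (λ y → trans (∑-cong V (λ x → trans
               (cong (λ b → h x * (k y * ⟦ b ⟧)) (c-sym x y)) (swap (h x) (k y) ⟦ c y x ⟧)))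
               (∑-*ˡ V (k y))) ⟩
        (∑[ y ∈ V ] k y * (∑[ x ∈ V ] h x * ⟦ c y x ⟧))   ∎
        where
        open ≡-Reasoning
        swap : ∀ a b e → a * (b * e) ≡ b * (a * e)
        swap = solve-∀

      -- Ordered clique edges are sorted by the kinds of their two ends. Mixed edges between far
      -- vertices and U are gathered at the far end to match `far-edges`.
      ∑cdeg≤ : ∑ V cdeg ≤ 3 * (D * Δ) + 2 * (∑ V by * D)
      ∑cdeg≤ = begin
        ∑ V cdeg
          ≤⟨ ∑-mono V pointwise ⟩
        -- The last two terms count pairs whose first, respectively second, end is of kind `by`;
        -- pairs with both ends of that kind are counted twice, hence an inequality.
        (∑[ x ∈ V ] (((far x * F x + far x * f x) + (via x * F x + via x * f x)) + (by x * cdeg x + W x)))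
          ≡⟨ trans (∑-+ V) (cong₂ _+_ (trans (∑-+ V) (cong₂ _+_ (∑-+ V) (∑-+ V))) (∑-+ V)) ⟩
        ((a₁ + a₂) + (a₃ + a₄)) + (a₅ + ∑ V W)
          ≡⟨ cong₂ (λ s t → ((a₁ + a₂) + (s + a₄)) + (a₅ + t)) (swap-ends via far) ∑W≡a₅ ⟩
        ((a₁ + a₂) + (a₂ + a₄)) + (a₅ + a₅)
          ≡⟨ regroup a₁ a₂ a₄ a₅ ⟩
        ((a₁ + 2 * a₂) + a₄) + 2 * a₅
          ≤⟨ +-mono-≤ (+-mono-≤ far-edges via-edges) (*-monoʳ-≤ 2 ∑by*cdeg≤) ⟩
        (3 * (∑[ x ∈ V ] far x * p x) + 3 * (∑[ x ∈ V ] via x * p x)) + 2 * (∑ V by * D)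
          ≤⟨ +-monoˡ-≤ (2 * (∑ V by * D)) (≤-trans
               (≤-reflexive (≡-sym (*-distribˡ-+ 3 (∑[ x ∈ V ] far x * p x) _)))
               (*-monoʳ-≤ 3 (≤-trans p-split ∑p≤DΔ))) ⟩
        3 * (D * Δ) + 2 * (∑ V by * D) ∎
        where
        open ≤-Reasoning
        a₁ a₂ a₃ a₄ a₅ : ℕ
        a₁ = ∑[ x ∈ V ] far x * F x
        a₂ = ∑[ x ∈ V ] far x * f x
        a₃ = ∑[ x ∈ V ] via x * F x
        a₄ = ∑[ x ∈ V ] via x * f x
        a₅ = ∑[ x ∈ V ] by x * cdeg x
        regroup : ∀ a b d e → ((a + b) + (b + d)) + (e + e) ≡ ((a + 2 * b) + d) + 2 * e
        regroup = solve-∀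
        ∑W≡a₅ : ∑ V W ≡ a₅
        ∑W≡a₅ = trans (∑-cong V (λ x → ≡-sym (*-identityˡ (W x)))) (trans (swap-ends (λ _ → 1) by)
          (∑-cong V (λ y → cong (by y *_) (∑-cong V (λ x → *-identityˡ ⟦ c y x ⟧)))))
        -- The factor 3 is generous, but it lets this bound merge with `far-edges` into a multiple
        -- of `∑ V p`.
        via-edges : a₄ ≤ 3 * (∑[ x ∈ V ] via x * p x)
        via-edges = ≤-trans (∑-mono V (λ x → *-monoʳ-≤ (via x) (f≤p x))) (m≤m+n _ _)
        p-split : (∑[ x ∈ V ] far x * p x) + (∑[ x ∈ V ] via x * p x) ≤ ∑ V p
        p-split = ≤-trans (≤-reflexive (≡-sym (∑-+ V))) (∑-mono V (λ x →
          ≤-trans (≤-reflexive (≡-sym (*-distribʳ-+ (p x) (far x) (via x))))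
          (≤-trans (*-monoˡ-≤ (p x) (far+via≤1 x)) (≤-reflexive (*-identityˡ (p x))))))
        expand : ∀ o u w F f W → (o + u + w) * (F + f + W) ≡
          (((o * F + o * f) + (u * F + u * f)) + (w * (F + f + W))) + (o + u) * W
        expand = solve-∀
        pointwise : ∀ x → cdeg x ≤
          ((far x * F x + far x * f x) + (via x * F x + via x * f x)) + (by x * cdeg x + W x)
        pointwise x rewrite cdeg-split x = begin
          F x + f x + W x
            ≡⟨ trans (≡-sym (*-identityˡ _)) (cong (_* (F x + f x + W x)) (≡-sym (trichotomy x))) ⟩
          (far x + via x + by x) * (F x + f x + W x)
            ≡⟨ expand (far x) (via x) (by x) (F x) (f x) (W x) ⟩
          (((far x * F x + far x * f x) + (via x * F x + via x * f x)) + by x * (F x + f x + W x))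
            + (far x + via x) * W x
            ≤⟨ +-monoʳ-≤ _ (≤-trans (*-monoˡ-≤ (W x) (far+via≤1 x)) (≤-reflexive (*-identityˡ (W x)))) ⟩
          (((far x * F x + far x * f x) + (via x * F x + via x * f x)) + by x * (F x + f x + W x)) + W x
            ≡⟨ +-assoc _ (by x * (F x + f x + W x)) (W x) ⟩
          ((far x * F x + far x * f x) + (via x * F x + via x * f x)) + (by x * (F x + f x + W x) + W x) ∎

      D-bound : 3 * (D * Δ) + 2 * (∑ V by * D) ≤ 3 * (Δ * Δ)
      D-bound = begin
        3 * (D * Δ) + 2 * (∑ V by * D)
          -- Weakening 2 to 3 and D to Δ gives both terms the common factor 3Δ.
          ≤⟨ +-monoʳ-≤ (3 * (D * Δ)) (*-mono-≤ (s≤s (s≤s (z≤n {1})))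
               (*-monoʳ-≤ (∑ V by) (≤-trans (m≤m+n D _) D+∑by≤Δ))) ⟩
        3 * (D * Δ) + 3 * (∑ V by * Δ)   ≡⟨ collect D (∑ V by) Δ ⟩
        3 * ((D + ∑ V by) * Δ)           ≤⟨ *-monoʳ-≤ 3 (*-monoˡ-≤ Δ D+∑by≤Δ) ⟩
        3 * (Δ * Δ)                      ∎
        where
        open ≤-Reasoning
        collect : ∀ a b e → 3 * (a * e) + 3 * (b * e) ≡ 3 * ((a + b) * e)
        collect = solve-∀

    -- The sum counts each edge from both ends, so a clique has at most 3Δ²/2 edges.
    strong-clique-bound : ∑ V cdeg ≤ 3 * (Δ * Δ)
    strong-clique-bound with maximiser cdeg V
    ... | inj₁ ∑≡0 = ≤-trans (≤-reflexive ∑≡0) z≤n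
    ... | inj₂ (v , pos , max) = ≤-trans (∑cdeg≤ v pos (λ x → max (∈-allFin x)))
                                         (D-bound v pos (λ x → max (∈-allFin x)))

-- Fractional strong edge colourings

toℚᵘ-/ : ∀ k l → toℚᵘ ((+ k) / suc l) ≃ᵘ mkℚᵘ (+ k) l
toℚᵘ-/ k l = ℚ.toℚᵘ-fromℚᵘ (mkℚᵘ (+ k) l)

/-distrib-+ : ∀ l j k → (+ (j + k)) / suc l ≡ (+ j) / suc l ℚ.+ (+ k) / suc l
/-distrib-+ l j k = ℚ.toℚᵘ-injective (begin
  toℚᵘ ((+ (j + k)) / suc l)                      ≈⟨ toℚᵘ-/ (j + k) l ⟩
  mkℚᵘ (+ (j + k)) l                              ≈⟨ *≡* (clear (+ j) (+ k) (+ suc l)) ⟩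
  mkℚᵘ (+ j) l ℚᵘ.+ mkℚᵘ (+ k) l                  ≈⟨ ℚᵘ.+-cong (toℚᵘ-/ j l) (toℚᵘ-/ k l) ⟨
  toℚᵘ ((+ j) / suc l) ℚᵘ.+ toℚᵘ ((+ k) / suc l)  ≈⟨ ℚ.toℚᵘ-homo-+ ((+ j) / suc l) ((+ k) / suc l) ⟨
  toℚᵘ ((+ j) / suc l ℚ.+ (+ k) / suc l)          ∎)
  where
  open ℚᵘ.≃-Reasoning
  clear : ∀ a b d → (a ℤ.+ b) ℤ.* (d ℤ.* d) ≡ (a ℤ.* d ℤ.+ b ℤ.* d) ℤ.* d
  clear = ℤSolver.solve-∀

n/n≡1 : ∀ l → (+ suc l) / suc l ≡ 1ℚ
n/n≡1 l = ℚ.toℚᵘ-injective (ℚᵘ.≃-trans (toℚᵘ-/ (suc l) l)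
  (*≡* (ℤ.*-comm (+ suc l) (+ 1))))

/-nonNeg : ∀ k l → 0ℚ ℚ.≤ (+ k) / suc l
/-nonNeg k l = ℚ.nonNegative⁻¹ ((+ k) / suc l) {{ℚ.normalize-nonNeg k (suc l)}}

/-≤-7/4 : ∀ t l m → 4 * t ≤ 7 * m * suc l → (+ t) / suc l ℚ.≤ ((+ 7) / 4) *ℚ ((+ m) / 1)
/-≤-7/4 t l m 4t≤ = ℚ.toℚᵘ-cancel-≤ (begin
  toℚᵘ ((+ t) / suc l)                     ≃⟨ toℚᵘ-/ t l ⟩
  mkℚᵘ (+ t) l                             ≤⟨ *≤* cross ⟩
  mkℚᵘ (+ 7) 3 ℚᵘ.* mkℚᵘ (+ m) 0           ≃⟨ ℚᵘ.*-cong (toℚᵘ-/ 7 3) (toℚᵘ-/ m 0) ⟨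
  toℚᵘ ((+ 7) / 4) ℚᵘ.* toℚᵘ ((+ m) / 1)   ≃⟨ ℚ.toℚᵘ-homo-* ((+ 7) / 4) ((+ m) / 1) ⟨
  toℚᵘ (((+ 7) / 4) *ℚ ((+ m) / 1))        ∎)
  where
  open ℚᵘ.≤-Reasoning
  cross : (+ t) ℤ.* (+ 4) ℤ.≤ ((+ 7) ℤ.* (+ m)) ℤ.* (+ suc l)
  cross = subst (ℤ._≤ ((+ 7) ℤ.* (+ m)) ℤ.* (+ suc l)) (ℤ.pos-* t 4)
    (subst (+ (t * 4) ℤ.≤_) (trans (ℤ.pos-* (7 * m) (suc l)) (cong (ℤ._* (+ suc l)) (ℤ.pos-* 7 m)))
      (ℤ.+≤+ (≤-trans (≤-reflexive (*-comm t 4)) 4t≤)))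

module _ {n : ℕ} (G : Graph n) where

  private
    Δ : ℕ
    Δ = maxDegree G

    V : List (Fin n)
    V = allFin n

  -- The conflict relation on edges

  adj-sym : ∀ {u v} → adj G u v ≡ true → adj G v u ≡ true
  adj-sym {u} {v} = trans (sym G v u)

  near-refl : ∀ u → near G u u ≡ true
  near-refl u = ∨⁺ˡ (dec-true (u ≟ u) refl)

  near-adj : ∀ {u x} → adj G u x ≡ true → near G u x ≡ true
  near-adj {u} {x} = ∨⁺ʳ (does (u ≟ x))

  near-sym : ∀ {u x} → near G u x ≡ true → near G x u ≡ true
  near-sym {u} n with near⁻ G n
  ... | inj₁ refl = near-refl u
  ... | inj₂ Aux  = near-adj (adj-sym Aux)

  touch⁺ : ∀ {u v x y} → (near G u x ≡ true ⊎ near G u y ≡ true) ⊎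
    (near G v x ≡ true ⊎ near G v y ≡ true) → touch G u v x y ≡ true
  touch⁺ {u} {v} {x} {y} (inj₁ (inj₁ q)) = ∨⁺ˡ (∨⁺ˡ q)
  touch⁺ {u} {v} {x} {y} (inj₁ (inj₂ q)) = ∨⁺ˡ (∨⁺ʳ (near G u x) q)
  touch⁺ {u} {v} {x} {y} (inj₂ (inj₁ q)) = ∨⁺ʳ (near G u x ∨ near G u y) (∨⁺ˡ q)
  touch⁺ {u} {v} {x} {y} (inj₂ (inj₂ q)) = ∨⁺ʳ (near G u x ∨ near G u y) (∨⁺ʳ (near G v x) q)

  touch-sym : ∀ u v x y → touch G u v x y ≡ true → touch G x y u v ≡ true
  touch-sym u v x y t with touch⁻ G {u} {v} {x} {y} t
  ... | inj₁ (inj₁ q) = touch⁺ {x} {y} (inj₁ (inj₁ (near-sym q)))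
  ... | inj₁ (inj₂ q) = touch⁺ {x} {y} (inj₂ (inj₁ (near-sym q)))
  ... | inj₂ (inj₁ q) = touch⁺ {x} {y} (inj₁ (inj₂ (near-sym q)))
  ... | inj₂ (inj₂ q) = touch⁺ {x} {y} (inj₂ (inj₂ (near-sym q)))

  touch-swapˡ : ∀ u v x y → touch G u v x y ≡ true → touch G v u x y ≡ true
  touch-swapˡ u v x y t with touch⁻ G {u} {v} {x} {y} t
  ... | inj₁ q = touch⁺ {v} {u} {x} {y} (inj₂ q)
  ... | inj₂ q = touch⁺ {v} {u} {x} {y} (inj₁ q)

  touch-swapʳ : ∀ u v x y → touch G u v x y ≡ true → touch G u v y x ≡ true
  touch-swapʳ u v x y = touch-sym y x u v ∘ touch-swapˡ x y u v ∘ touch-sym u v x y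

  -- The edge uv with u < v is encoded as combine u v; other codes are no edges.
  edge : Fin n → Fin n → Bool
  edge u v = does (u Fin.<? v) ∧ adj G u v

  end₁ end₂ : Fin (n * n) → Fin n
  end₁ e = proj₁ (remQuot {n} n e)
  end₂ e = proj₂ (remQuot {n} n e)

  ends-combine : ∀ {A : Set} (f : Fin n → Fin n → A) u v →
    f (end₁ (combine u v)) (end₂ (combine u v)) ≡ f u v
  ends-combine f u v = cong (λ e → f (proj₁ e) (proj₂ e)) (remQuot-combine u v)

  isEdge : Fin (n * n) → Bool
  isEdge e = edge (end₁ e) (end₂ e)

  conflict : Fin (n * n) → Fin (n * n) → Bool
  conflict e e′ = touch G (end₁ e) (end₂ e)
                          (end₁ e′) (end₂ e′)

  isEdge-combine : ∀ u v → isEdge (combine u v) ≡ edge u v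
  isEdge-combine = ends-combine edge

  conflict-combine : ∀ u v x y → conflict (combine u v) (combine x y) ≡ touch G u v x y
  conflict-combine u v x y =
    trans (ends-combine (λ a b → touch G a b _ _) u v) (ends-combine (touch G u v) x y)

  conflict-refl : ∀ e → conflict e e ≡ true
  conflict-refl e = touch⁺ {end₁ e} {end₂ e} (inj₁ (inj₁ (near-refl _)))

  conflict-sym : ∀ e e′ → conflict e e′ ≡ true → conflict e′ e ≡ true
  conflict-sym e e′ = touch-sym (end₁ e) (end₂ e) _ _

  edge⁻ : ∀ {u v} → edge u v ≡ true → u Fin.< v × adj G u v ≡ true
  edge⁻ {u} {v} q = dec-true⁻ (u Fin.<? v) (proj₁ (∧⁻ q)) , proj₂ (∧⁻ {does (u Fin.<? v)} q)

  edge⁺ : ∀ {u v} → u Fin.< v → adj G u v ≡ true → edge u v ≡ true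
  edge⁺ {u} {v} u<v Auv = cong₂ _∧_ (dec-true (u Fin.<? v) u<v) Auv

  edge-asym : ∀ {u v} → edge u v ≡ true → edge v u ≡ false
  edge-asym {u} {v} q = ¬-not (λ q′ → <-asym (proj₁ (edge⁻ {u} q)) (proj₁ (edge⁻ {v} q′)))

  edge+edge≤adj : ∀ u v → ⟦ edge u v ⟧ + ⟦ edge v u ⟧ ≤ ⟦ adj G u v ⟧
  edge+edge≤adj u v with edge u v in euv
  ... | true  rewrite edge-asym {u} euv | proj₂ (edge⁻ {u} euv) = ≤-refl
  ... | false = ⟦⟧-mono (edge v u) (λ evu →
    ≤-reflexive (cong ⟦_⟧ (≡-sym (adj-sym (proj₂ (edge⁻ {v} evu))))))

  -- Degrees in the conflict graph

  -- As u and v are neighbours of each other, a touching edge always has an end adjacent to u or v.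
  -- There are at most 2Δ such ends, with multiplicity, and each lies on at most Δ edges.
  touching-edges : ∀ u v → adj G u v ≡ true →
    ∑[ x ∈ V ] ∑[ y ∈ V ] ⟦ touch G u v x y ∧ edge x y ⟧ ≤ 2 * (Δ * Δ)
  touching-edges u v Auv = begin
    (∑[ x ∈ V ] ∑[ y ∈ V ] ⟦ touch G u v x y ∧ edge x y ⟧)
      ≤⟨ ∑-mono V (λ x → ∑-mono V (pointwise x)) ⟩
    (∑[ x ∈ V ] ∑[ y ∈ V ] (b x * ⟦ edge x y ⟧ + b y * ⟦ edge x y ⟧))
      ≡⟨ trans (∑-cong V (λ x → ∑-+ V)) (∑-+ V) ⟩
    (∑[ x ∈ V ] ∑[ y ∈ V ] b x * ⟦ edge x y ⟧) + (∑[ x ∈ V ] ∑[ y ∈ V ] b y * ⟦ edge x y ⟧)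
      ≡⟨ cong₂ _+_ refl (∑-swap V V) ⟩
    (∑[ x ∈ V ] ∑[ y ∈ V ] b x * ⟦ edge x y ⟧) + (∑[ x ∈ V ] ∑[ y ∈ V ] b x * ⟦ edge y x ⟧)
      ≡⟨ trans (∑-cong V (λ x → ∑-+ V)) (∑-+ V) ⟨
    (∑[ x ∈ V ] ∑[ y ∈ V ] (b x * ⟦ edge x y ⟧ + b x * ⟦ edge y x ⟧))
      ≤⟨ ∑-mono V (λ x → ∑-mono V (λ y → ≤-trans
           (≤-reflexive (≡-sym (*-distribˡ-+ (b x) ⟦ edge x y ⟧ ⟦ edge y x ⟧)))
           (*-monoʳ-≤ (b x) (edge+edge≤adj x y)))) ⟩
    (∑[ x ∈ V ] ∑[ y ∈ V ] b x * ⟦ adj G x y ⟧)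
      ≡⟨ ∑-cong V (λ x → ∑-*ˡ V (b x)) ⟩
    (∑[ x ∈ V ] b x * (∑[ y ∈ V ] ⟦ adj G x y ⟧))
      ≤⟨ ∑-mono V (λ x → *-monoʳ-≤ (b x) (∑adj≤maxDegree G x)) ⟩
    (∑[ x ∈ V ] b x * Δ)
      ≡⟨ ∑-*ʳ V Δ ⟩
    ∑ V b * Δ
      ≡⟨ cong (_* Δ) (∑-+ V) ⟩
    ((∑[ x ∈ V ] ⟦ adj G u x ⟧) + (∑[ x ∈ V ] ⟦ adj G v x ⟧)) * Δ
      ≤⟨ *-monoˡ-≤ Δ (+-mono-≤ (∑adj≤maxDegree G u) (∑adj≤maxDegree G v)) ⟩
    (Δ + Δ) * Δ
      ≡⟨ double Δ ⟩
    2 * (Δ * Δ) ∎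
    where
    open ≤-Reasoning
    double : ∀ k → (k + k) * k ≡ 2 * (k * k)
    double = solve-∀
    b : Fin n → ℕ
    b x = ⟦ adj G u x ⟧ + ⟦ adj G v x ⟧
    near-u : ∀ {x} → near G u x ≡ true → 1 ≤ b x
    near-u q with near⁻ G q
    ... | inj₁ refl rewrite adj-sym Auv = m≤n+m 1 ⟦ adj G u u ⟧
    ... | inj₂ Aux  rewrite Aux = s≤s z≤n
    near-v : ∀ {x} → near G v x ≡ true → 1 ≤ b x
    near-v q with near⁻ G q
    ... | inj₁ refl rewrite Auv = s≤s z≤n
    ... | inj₂ Avx  rewrite Avx = m≤n+m 1 _
    reached : ∀ x y → touch G u v x y ≡ true → 1 ≤ b x + b y
    reached x y t with touch⁻ G {u} {v} {x} {y} t
    ... | inj₁ (inj₁ q) = ≤-trans (near-u q) (m≤m+n _ _)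
    ... | inj₁ (inj₂ q) = ≤-trans (near-u q) (m≤n+m _ (b x))
    ... | inj₂ (inj₁ q) = ≤-trans (near-v q) (m≤m+n _ _)
    ... | inj₂ (inj₂ q) = ≤-trans (near-v q) (m≤n+m _ (b x))
    pointwise : ∀ x y → ⟦ touch G u v x y ∧ edge x y ⟧ ≤ b x * ⟦ edge x y ⟧ + b y * ⟦ edge x y ⟧
    pointwise x y = begin
      ⟦ touch G u v x y ∧ edge x y ⟧          ≡⟨ ⟦∧⟧ (touch G u v x y) (edge x y) ⟩
      ⟦ touch G u v x y ⟧ * ⟦ edge x y ⟧
        ≤⟨ *-monoˡ-≤ ⟦ edge x y ⟧ (⟦⟧-mono (touch G u v x y) (reached x y)) ⟩
      (b x + b y) * ⟦ edge x y ⟧              ≡⟨ *-distribʳ-+ ⟦ edge x y ⟧ (b x) (b y) ⟩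
      b x * ⟦ edge x y ⟧ + b y * ⟦ edge x y ⟧ ∎

  conflict-degree : ∀ e → isEdge e ≡ true →
    ∑[ e′ ∈ allFin (n * n) ] ⟦ conflict e e′ ∧ isEdge e′ ⟧ ≤ 2 * (Δ * Δ)
  conflict-degree e e-edge = ≤-trans (≤-reflexive (trans (∑-combine n n _)
    (∑-cong V (λ x → ∑-cong V (λ y → cong ⟦_⟧ (cong₂ _∧_
      (ends-combine (touch G u v) x y) (isEdge-combine x y)))))))
    (touching-edges u v (proj₂ (edge⁻ {u} e-edge)))
    where
    u v : Fin n
    u = end₁ e
    v = end₂ e

  -- Cliques in the conflict graph

  -- Codes carry an orientation; reading both makes the relation symmetric, as `StrongClique` and
  -- `EdgeSet` require.
  unordered : (Fin (n * n) → Bool) → Fin n → Fin n → Bool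
  unordered q u v = q (combine u v) ∨ q (combine v u)

  unordered-sym : ∀ q u v → unordered q u v ≡ unordered q v u
  unordered-sym q u v = ∨-comm (q (combine u v)) (q (combine v u))

  module _ (q : Fin (n * n) → Bool) (q⊆edges : ∀ e → q e ≡ true → isEdge e ≡ true) where

    ordered : ∀ {u v} → q (combine u v) ≡ true → edge u v ≡ true
    ordered {u} {v} quv = trans (≡-sym (isEdge-combine u v)) (q⊆edges _ quv)

    unordered⊆adj : ∀ u v → unordered q u v ≡ true → adj G u v ≡ true
    unordered⊆adj u v quv with ∨⁻ (q (combine u v)) quv
    ... | inj₁ uv = proj₂ (edge⁻ {u} (ordered uv))
    ... | inj₂ vu = adj-sym (proj₂ (edge⁻ {v} (ordered vu)))

    unordered-count : ∀ u v → ⟦ q (combine u v) ⟧ + ⟦ q (combine v u) ⟧ ≤ ⟦ unordered q u v ⟧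
    unordered-count u v with q (combine u v) in quv | q (combine v u) in qvu
    ... | false | false = z≤n
    ... | false | true  = ≤-refl
    ... | true  | false = ≤-refl
    ... | true  | true  = contradiction
      (trans (≡-sym (ordered qvu)) (edge-asym {u} (ordered quv))) λ ()

    -- An edge has one code but two ordered pairs of ends, and by `edge-asym` no pair is reached
    -- from two codes.
    2∑≤∑∑unordered : 2 * (∑[ e ∈ allFin (n * n) ] ⟦ q e ⟧) ≤
                     ∑[ u ∈ V ] ∑[ v ∈ V ] ⟦ unordered q u v ⟧
    2∑≤∑∑unordered = begin
      2 * (∑[ e ∈ allFin (n * n) ] ⟦ q e ⟧)   ≡⟨ cong (2 *_) (∑-combine n n _) ⟩
      2 * s                                   ≡⟨ cong₂ _+_ (refl {x = s}) (+-identityʳ s) ⟩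
      s + s                                   ≡⟨ cong₂ _+_ (refl {x = s}) (∑-swap V V) ⟩
      s + (∑[ u ∈ V ] ∑[ v ∈ V ] ⟦ q (combine v u) ⟧)
        ≡⟨ trans (∑-cong V (λ u → ∑-+ V)) (∑-+ V) ⟨
      (∑[ u ∈ V ] ∑[ v ∈ V ] (⟦ q (combine u v) ⟧ + ⟦ q (combine v u) ⟧))
        ≤⟨ ∑-mono V (λ u → ∑-mono V (unordered-count u)) ⟩
      (∑[ u ∈ V ] ∑[ v ∈ V ] ⟦ unordered q u v ⟧) ∎
      where
      open ≤-Reasoning
      s : ℕ
      s = ∑[ u ∈ V ] ∑[ v ∈ V ] ⟦ q (combine u v) ⟧

  open FractionalColouring conflict conflict-refl conflict-sym

  -- Rounding down is harmless: clique sizes are integers, and the final estimate uses only that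
  -- twice this number is at most 3Δ².
  ω : ℕ
  ω = (3 * (Δ * Δ)) ℕ./ 2

  conflict-clique : CliquesBoundedBy ω isEdge
  conflict-clique Q Q⊆edges clique = ≤-trans (≤-reflexive (≡-sym (m*n/n≡m _ 2))) (/-monoˡ-≤ 2 (begin
    (∑[ e ∈ allFin (n * n) ] ⟦ Q e ⟧) * 2   ≡⟨ *-comm (∑[ e ∈ allFin (n * n) ] ⟦ Q e ⟧) 2 ⟩
    2 * (∑[ e ∈ allFin (n * n) ] ⟦ Q e ⟧)   ≤⟨ 2∑≤∑∑unordered Q Q⊆edges ⟩
    (∑[ u ∈ V ] ∑[ v ∈ V ] ⟦ unordered Q u v ⟧)
      ≤⟨ StrongClique.strong-clique-bound G (unordered Q) (unordered-sym Q)
           (unordered⊆adj Q Q⊆edges) touching ⟩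
    3 * (Δ * Δ) ∎))
    where
    open ≤-Reasoning
    touch-codes : ∀ u v x y → Q (combine u v) ≡ true → Q (combine x y) ≡ true → touch G u v x y ≡ true
    touch-codes u v x y quv qxy = trans (≡-sym (conflict-combine u v x y)) (clique _ _ quv qxy)
    touching : ∀ u v x y → unordered Q u v ≡ true → unordered Q x y ≡ true → touch G u v x y ≡ true
    touching u v x y quv qxy with ∨⁻ (Q (combine u v)) quv | ∨⁻ (Q (combine x y)) qxy
    ... | inj₁ uv | inj₁ xy = touch-codes u v x y uv xy
    ... | inj₁ uv | inj₂ yx = touch-swapʳ u v y x (touch-codes u v y x uv yx)
    ... | inj₂ vu | inj₁ xy = touch-swapˡ v u x y (touch-codes v u x y vu xy)
    ... | inj₂ vu | inj₂ yx = touch-swapˡ v u x y (touch-swapʳ v u y x (touch-codes v u y x vu yx))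

  -- Stable sets as induced matchings

  module _ {S : Subset (n * n)} (stable : Stable isEdge S) where

    edgeSet : EdgeSet G
    edgeSet = record
      { mem     = unordered (lookup S)
      ; mem-sym = unordered-sym (lookup S)
      ; mem-adj = unordered⊆adj (lookup S) (within stable)
      }

    same-code : ∀ {u v x y} → S ∋ combine u v → S ∋ combine x y → touch G u v x y ≡ true → u ≡ x × v ≡ y
    same-code {u} {v} {x} {y} uv∈ xy∈ t = combine-injective u v x y
      (independent stable _ _ uv∈ xy∈ (trans (conflict-combine u v x y) t))

    touching⇒same : ∀ {u v x y} → unordered (lookup S) u v ≡ true → unordered (lookup S) x y ≡ true →
      touch G u v x y ≡ true → SameEdge u v x y
    touching⇒same {u} {v} {x} {y} uv∈ xy∈ t
      with ∨⁻ (lookup S (combine u v)) uv∈ | ∨⁻ (lookup S (combine x y)) xy∈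
    ... | inj₁ uv | inj₁ xy = inj₁ (same-code uv xy t)
    ... | inj₁ uv | inj₂ yx = inj₂ (same-code uv yx (touch-swapʳ u v x y t))
    ... | inj₂ vu | inj₁ xy with v≡x , u≡y ← same-code vu xy (touch-swapˡ u v x y t) = inj₂ (u≡y , v≡x)
    ... | inj₂ vu | inj₂ yx
      with v≡y , u≡x ← same-code vu yx (touch-swapˡ u v y x (touch-swapʳ u v x y t)) = inj₁ (u≡x , v≡y)

    -- Each forbidden configuration, a common endpoint or a joining edge, makes the two edges touch,
    -- and touching edges of a stable set coincide.
    inducedMatching : InducedMatching G
    inducedMatching = edgeSet , λ u v x y uv∈ xy∈ distinct →
      let apart = λ q → distinct (touching⇒same {u} {v} {x} {y} uv∈ xy∈ (touch⁺ {u} {v} {x} {y} q)) in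
      ( (λ { refl → apart (inj₁ (inj₁ (near-refl u))) })
      , (λ { refl → apart (inj₁ (inj₂ (near-refl u))) })
      , (λ { refl → apart (inj₂ (inj₁ (near-refl v))) })
      , (λ { refl → apart (inj₂ (inj₂ (near-refl v))) })) ,
      ( (λ e → apart (inj₁ (inj₁ (near-adj e))))
      , (λ e → apart (inj₁ (inj₂ (near-adj e))))
      , (λ e → apart (inj₂ (inj₁ (near-adj e))))
      , (λ e → apart (inj₂ (inj₂ (near-adj e)))))

  -- From multiplicities to rational weights

  module _ (l : ℕ) where

    weighting : ∀ es → (∀ {e} → e ∈ es → Stable isEdge (proj₁ e)) → Weighting G
    weighting []             st = []
    weighting ((S , k) ∷ es) st =
      (inducedMatching (st (here refl)) , (+ k) / suc l) ∷ weighting es (st ∘ there)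

    weighting-nonNeg : ∀ es (st : ∀ {e} → e ∈ es → Stable isEdge (proj₁ e)) → NonNeg (weighting es st)
    weighting-nonNeg []             st = _
    weighting-nonNeg ((S , k) ∷ es) st = /-nonNeg k l , weighting-nonNeg es (st ∘ there)

    0/n≡0 : (+ 0) / suc l ≡ 0ℚ
    0/n≡0 = ℚ.toℚᵘ-injective (ℚᵘ.≃-trans (toℚᵘ-/ 0 l) (*≡* refl))

    weight-weighting : ∀ es (st : ∀ {e} → e ∈ es → Stable isEdge (proj₁ e)) →
      weight (weighting es st) ≡ (+ total es) / suc l
    weight-weighting []             st = ≡-sym 0/n≡0
    weight-weighting ((S , k) ∷ es) st = trans
      (cong₂ ℚ._+_ (refl {x = (+ k) / suc l}) (weight-weighting es (st ∘ there)))
      (≡-sym (/-distrib-+ l k (total es)))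

    -- The hypothesis singles out `e` as the code of uv: membership of uv, which reads two codes,
    -- becomes membership of `e` alone.
    load-weighting : ∀ {u v e} → (∀ {S} → Stable isEdge S → unordered (lookup S) u v ≡ lookup S e) →
      ∀ es (st : ∀ {e} → e ∈ es → Stable isEdge (proj₁ e)) →
      load (weighting es st) u v ≡ (+ covered es e) / suc l
    load-weighting code []             st = ≡-sym 0/n≡0
    load-weighting {u} {v} {e} code ((S , k) ∷ es) st = trans
      (cong₂ ℚ._+_ (trans (cong (if_then (+ k) / suc l else 0ℚ) (code (st (here refl))))
                          (scale (lookup S e)))
                   (load-weighting {u} {v} {e} code es (st ∘ there)))
      (≡-sym (/-distrib-+ l (⟦ lookup S e ⟧ * k) (covered es e)))
      where
      scale : ∀ b → (if b then (+ k) / suc l else 0ℚ) ≡ (+ (⟦ b ⟧ * k)) / suc l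
      scale true  = cong (λ j → (+ j) / suc l) (≡-sym (*-identityˡ k))
      scale false = ≡-sym 0/n≡0

  -- Only the increasing order of the ends is the code of an edge, so a stable set never contains
  -- the other one.
  edge-code : ∀ u v → adj G u v ≡ true → ∃ λ e → isEdge e ≡ true ×
    (∀ {S} → Stable isEdge S → unordered (lookup S) u v ≡ lookup S e)
  edge-code u v Auv with Fin.<-cmp u v
  ... | tri< u<v _ _ = combine u v , trans (isEdge-combine u v) uv , λ {S} st →
      trans (cong (lookup S (combine u v) ∨_) (vu∉ st)) (∨-identityʳ _)
    where
    uv : edge u v ≡ true
    uv = edge⁺ u<v Auv
    vu∉ : ∀ {S} → Stable isEdge S → lookup S (combine v u) ≡ false
    vu∉ {S} st = ¬-not λ vu∈ → contradiction
      (trans (≡-sym (ordered (lookup S) (within st) vu∈)) (edge-asym {u} uv)) λ ()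
  ... | tri≈ _ refl _ = contradiction (trans (≡-sym Auv) (irrefl G u)) λ ()
  ... | tri> _ _ v<u = combine v u , trans (isEdge-combine v u) vu , λ {S} st →
      cong (_∨ lookup S (combine v u)) (uv∉ st)
    where
    vu : edge v u ≡ true
    vu = edge⁺ v<u (adj-sym Auv)
    uv∉ : ∀ {S} → Stable isEdge S → lookup S (combine u v) ≡ false
    uv∉ {S} st = ¬-not λ uv∈ → contradiction
      (trans (≡-sym (ordered (lookup S) (within st) uv∈)) (edge-asym {v} vu)) λ ()

  coloured⇒χ'fs≤ : (∃ λ es → ∃ λ L → 0 < L ×
      (∀ {e} → e ∈ es → Stable isEdge (proj₁ e)) ×
      (∀ e → isEdge e ≡ true → covered es e ≡ L) ×
      2 * total es ≤ (2 * (Δ * Δ) + ω) * L) →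
    χ'fs≤ G (((+ 7) / 4) *ℚ ((+ (Δ * Δ)) / 1))
  coloured⇒χ'fs≤ (es , suc l , _ , st , full , 2*total≤) =
    weighting l es st , (weighting-nonNeg l es st , loads) ,
    ℚ.≤-trans (ℚ.≤-reflexive (weight-weighting l es st)) (/-≤-7/4 (total es) l (Δ * Δ) 4*total≤)
    where
    loads : ∀ u v → Adj G u v → load (weighting l es st) u v ≡ 1ℚ
    loads u v Auv with e , e-edge , code ← edge-code u v Auv =
      trans (load-weighting l {u} {v} {e} code es st)
        (trans (cong (λ k → (+ k) / suc l) (full e e-edge)) (n/n≡1 l))
    -- The 7 is 4 + 3: twice the degree bound 2Δ² plus twice the clique bound.
    4*total≤ : 4 * total es ≤ 7 * (Δ * Δ) * suc l
    4*total≤ = begin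
      4 * total es                            ≡⟨ *-assoc 2 2 (total es) ⟩
      2 * (2 * total es)                      ≤⟨ *-monoʳ-≤ 2 2*total≤ ⟩
      2 * ((2 * (Δ * Δ) + ω) * suc l)         ≡⟨ expand (Δ * Δ) ω (suc l) ⟩
      (4 * (Δ * Δ) + ω * 2) * suc l
        ≤⟨ *-monoˡ-≤ (suc l) (+-monoʳ-≤ (4 * (Δ * Δ)) (m/n*n≤m (3 * (Δ * Δ)) 2)) ⟩
      (4 * (Δ * Δ) + 3 * (Δ * Δ)) * suc l     ≡⟨ cong (_* suc l) (*-distribʳ-+ (Δ * Δ) 4 3) ⟨
      7 * (Δ * Δ) * suc l                     ∎
      where
      open ≤-Reasoning
      expand : ∀ m w k → 2 * ((2 * m + w) * k) ≡ (4 * m + w * 2) * k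
      expand = solve-∀

theorem3 : ∀ (n : ℕ) (G : Graph n) →
    χ'fs≤ G (((+ 7) / 4) *ℚ ((+ (maxDegree G * maxDegree G)) / 1))
theorem3 n G = coloured⇒χ'fs≤ G
  (FractionalColouring.fractional-colouring (conflict G) (conflict-refl G) (conflict-sym G)
    (isEdge G) (conflict-degree G) (conflict-clique G))
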